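{- Let $\ell,r\ge1$ be integers, $N=\ell+r$, $\Delta=\gcd(\ell,r)$, and for a positive integer $m$ let $\Delta_m=\gcd(\Delta,m)$. Consider the canonical negative-negative double Boolean automata circuit $D_{\ell,r}$ (both side-circuits negative, of sizes $\ell$ and $r$). Let $p\in\mathbb{N}$ divide $N$ but divide neither $\ell$ nor $r$. Then the number $C_p(\ell,r)$ of configurations of period $p$ of $D_{\ell,r}$ depends only on $p$ and $\Delta_p$; it is given by $$C_p(\ell,r)=C_{p,\Delta_p}=P\!\left(\frac p{\Delta_p}\right)^{\Delta_p}.$$ The number of attractors of period $p$ and the total number of attractors of $D_{\ell,r}$ are respectively given by $$\mathtt{A}^{=}_p(\ell,r)=\frac1p\sum_{q\mid p}\mu\!\left(\frac pq\right)P\!\left(\frac q{\Delta_q}\right)^{\Delta_q},\qquad \mathtt{T}^{=}(\ell,r)=\frac1N\sum_{m\mid N}\psi\!\left(\frac Nm\right)P\!\left(\frac m{\Delta_m}\right)^{\Delta_m}$$ (the formula for $\mathtt{T}^{=}(\ell,r)$ involves no choice of $p$, and shows that $\mathtt{T}^{=}(\ell,r)$ depends only on $N$ and $\Delta$).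
   Context: The canonical negative-negative double Boolean automata circuit $D_{\ell,r}$ has $n=\ell+r-1$ nodes $0,\ldots,n-1$. For a configuration $x=(x_0,\ldots,x_{n-1})\in\{0,1\}^n$ write $x^L=(x_0,\ldots,x_{\ell-1})$ (states of the left-circuit) and $x^R=(x_0,x_\ell,\ldots,x_{n-1})$ (states of the right-circuit, $r$ entries; $x^R=(x_0)$ if $r=1$). All nodes are updated in parallel by $F:\{0,1\}^n\to\{0,1\}^n$: $F(x)_i=x_{i-1}$ for $i\notin\{0,\ell\}$; $F(x)_\ell=x_0$ (if $r\ge2$); and $F(x)_0=\neg a\vee\neg b$, where $a=x_{\ell-1}$ is the last entry of $x^L$ and $b$ is the last entry of $x^R$ (so $b=x_{n-1}$ when $r\ge 2$, and $b=x_0$ when $r=1$). A configuration $x$ has period $p$ if $F^{p}(x)=x$ ($p$ need not be minimal); it has exact period $p$ if moreover it has no period $d<p$, $d\ge1$. An attractor of period $p$ is the orbit under $F$ of a configuration of exact period $p$ (fixed points are the attractors of period $1$); the total number of attractors counts attractors of all periods. $\mu$ is the Möbius function and $\psi$ is Euler's totient function. $P$ is the Perrin sequence: $P(0)=3$, $P(1)=0$, $P(2)=2$, $P(m)=P(m-2)+P(m-3)$ for $m\ge3$. -}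

module Defs where

open import Data.Bool using (Bool; not; _∨_; if_then_else_)
open import Data.Fin using (Fin; zero; suc; toℕ; inject₁)
open import Data.Integer as ℤ using (ℤ; +_; 0ℤ; -1ℤ)
open import Data.List using (List; length; filter; map; foldr; upTo)
open import Data.List.Relation.Unary.Unique.DecPropositional using (unique?)
open import Data.Nat
open import Data.Nat.Coprimality using (coprime?)
open import Data.Nat.DivMod using (_/_)
open import Data.Nat.Divisibility using (_∣?_)
open import Data.Nat.GCD using (gcd; gcd[m,n]≢0)
open import Data.Nat.Primality.Factorisation using (factorise; factors)
open import Data.Product using (∃; ∃-syntax; _×_; proj₁)
open import Data.Sum using (inj₂)
open import Data.Vec as Vec using (Vec; _∷_; head; last; lookup; tabulate; take; drop)
import Function.Endo.Propositional as Endo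
open import Function.Bundles using (Inverse)
open import Level using (0ℓ)
open import Relation.Binary.Bundles using (Setoid)
import Relation.Binary.Construct.On as On
open import Relation.Binary.PropositionalEquality using (_≡_; setoid)
open import Relation.Nullary using (¬_; does)
open import Relation.Unary using (Pred)
open import Relation.Unary.Relation.Binary.Equality using (≐-setoid)

-- For r ≥ 1, ℓ + pred r is ℓ + r - 1.
Config : ℕ → ℕ → Set
Config ℓ r = Vec Bool (ℓ + pred r)

leftCircuit : ∀ ℓ r → Config ℓ r → Vec Bool ℓ
leftCircuit ℓ r x = take ℓ x

rightCircuit : ∀ ℓ r .{{_ : NonZero ℓ}} .{{_ : NonZero r}} → Config ℓ r → Vec Bool r
rightCircuit ℓ@(suc _) (suc _) x = head x ∷ drop ℓ x

F : ∀ ℓ r .{{_ : NonZero ℓ}} .{{_ : NonZero r}} → Config ℓ r → Config ℓ r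
F ℓ@(suc _) r@(suc _) x = tabulate next
  where
  next : Fin (ℓ + pred r) → Bool
  next zero    = not (last (leftCircuit ℓ r x)) ∨ not (last (rightCircuit ℓ r x))
  next (suc i) = if does (toℕ (suc i) ≟ ℓ) then head x else lookup x (inject₁ i)

module _ (ℓ r : ℕ) .{{_ : NonZero ℓ}} .{{_ : NonZero r}} where

  F^ : ℕ → Config ℓ r → Config ℓ r
  F^ k = F ℓ r ^ᶠ k
    where open Endo (Config ℓ r) renaming (_^_ to _^ᶠ_)

  HasPeriod : ℕ → Config ℓ r → Set
  HasPeriod p x = F^ p x ≡ x

  HasExactPeriod : ℕ → Config ℓ r → Set
  HasExactPeriod p x =
    1 ≤ p × HasPeriod p x × (∀ d → 1 ≤ d → d < p → ¬ HasPeriod d x)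

  orbit : Config ℓ r → Pred (Config ℓ r) 0ℓ
  orbit x y = ∃[ k ] F^ k x ≡ y

  PeriodicConfigs : ℕ → Setoid 0ℓ 0ℓ
  PeriodicConfigs p = On.setoid (setoid (Config ℓ r)) (proj₁ {B = HasPeriod p})

  -- An attractor is presented by any of its configurations; two presentations
  -- are identified when the orbits are equal as sets of configurations.
  Orbits : (Config ℓ r → Set) → Setoid 0ℓ 0ℓ
  Orbits P = On.setoid (≐-setoid (Config ℓ r) 0ℓ) (λ (x : ∃ P) → orbit (proj₁ x))

  AttractorsOfPeriod : ℕ → Setoid 0ℓ 0ℓ
  AttractorsOfPeriod p = Orbits (HasExactPeriod p)

  Attractors : Setoid 0ℓ 0ℓ
  Attractors = Orbits (λ x → ∃[ p ] HasExactPeriod p x)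

+-nonZero : ∀ m n .{{_ : NonZero m}} → NonZero (m + n)
+-nonZero (suc m) n = _

HasCardinality : Setoid 0ℓ 0ℓ → ℕ → Set
HasCardinality S k = Inverse S (setoid (Fin k))

perrin : ℕ → ℕ
perrin 0 = 3
perrin 1 = 0
perrin 2 = 2
perrin (suc (suc (suc m))) = perrin (suc m) + perrin m

Δ : ℕ → ℕ → ℕ → ℕ
Δ ℓ r m = gcd (gcd ℓ r) m

Δ-nonZero : ∀ ℓ r m .{{_ : NonZero m}} → NonZero (Δ ℓ r m)
Δ-nonZero ℓ r m = ≢-nonZero (gcd[m,n]≢0 (gcd ℓ r) m (inj₂ (≢-nonZero⁻¹ m)))

C : (m d : ℕ) .{{_ : NonZero d}} → ℕ
C m d = perrin (m / d) ^ d

CΔ : (ℓ r m : ℕ) .{{_ : NonZero m}} → ℕ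
CΔ ℓ r m = C m (Δ ℓ r m)
  where instance Δ≢0 = Δ-nonZero ℓ r m

-- The value at 0 is arbitrary.
μ : ℕ → ℤ
μ zero      = 0ℤ
μ n@(suc _) = if does (unique? _≟_ ps) then -1ℤ ℤ.^ length ps else 0ℤ
  where
  ps : List ℕ
  ps = factors (factorise n)

ψ : ℕ → ℕ
ψ n = length (filter (λ k → coprime? k n) (map suc (upTo n)))

-- Divisors are enumerated as suc i, so that the summand may divide by them.
sumOverDivisors : (n : ℕ) → ((d : ℕ) .{{_ : NonZero d}} → ℤ) → ℤ
sumOverDivisors n f =
  foldr ℤ._+_ 0ℤ (map (λ i → f (suc i)) (filter (λ i → suc i ∣? n) (upTo n)))

infix 5 sumOverDivisors
syntax sumOverDivisors n (λ d → e) = ∑[ d ∣ n ] e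

{-# OPTIONS --safe #-}

-- On a trajectory the state u t of node 0 satisfies u (t + ℓ + r) = nand (u (t + r)) (u (t + ℓ)), and
-- the other nodes show delayed copies of u. A zero of u at t forces ones at t + ℓ and t + r, hence a
-- zero at t + N, so every periodic configuration has period N. If m divides N, the configurations of
-- period m are therefore the m-periodic u with u t = nand (u (t + ℓ)) (u (t - ℓ)); reading u in steps
-- of ℓ splits it into δ = gcd (ℓ, m) independent cyclic words of length m / δ in which every letter is
-- the nand of its two neighbours, and the transfer matrix M of this rule satisfies M³ = M + 1, which is
-- the Perrin recursion. The attractors are then counted by writing C_q as the number of periodic x whose
-- exact period divides q and summing over x first, with ∑ μ (d) = [n = 1] and ∑ ψ (d) = n over d ∣ n.
module Submission where

open import Algebra.Properties.CommutativeSemigroup using (interchange; x∙yz≈y∙xz)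
open import Data.Bool using (Bool; true; false; not; _∨_; _∧_; if_then_else_; T; T?)
open import Data.Bool.Properties using (if-float; T-∧) renaming (_≟_ to _≟ᵇ_)
open import Data.Fin
  using (Fin; zero; suc; toℕ; fromℕ; inject₁; _↑ˡ_; _↑ʳ_; finToFun; funToFin; combine)
open import Data.Fin.Permutation using (↔⇒≡)
open import Data.Fin.Properties
  using (finToFun-funToFin; funToFin-finToFin; toℕ-↑ˡ; toℕ-↑ʳ; toℕ-fromℕ; toℕ-inject₁; toℕ<n;
         toℕ-fromℕ<; fromℕ<-toℕ; fromℕ<-cong)
open import Data.Integer as ℤ using (ℤ; +_; 0ℤ; 1ℤ; -1ℤ)
import Data.Integer.Properties as ℤ
open import Data.List as List
  using (List; []; _∷_; _++_; map; length; filter; foldr; upTo; applyUpTo; concatMap; deduplicate)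
open import Data.List.Membership.Propositional using (_∈_)
open import Data.List.Membership.Propositional.Properties
  using (∈-lookup; ∈-map⁺; ∈-map⁻; ∈-++⁺ˡ; ∈-++⁺ʳ; ∈-++⁻; ∈-filter⁺; ∈-filter⁻; ∈-upTo⁺; ∈-upTo⁻;
         ∈-applyUpTo⁺; ∈-applyUpTo⁻; ∈-concatMap⁺; ∈-concatMap⁻)
open import Data.List.Membership.Propositional.Properties.WithK using (unique∧set⇒bag)
import Data.List.Membership.Setoid as SetoidMembership
open import Data.List.Membership.Setoid.Properties using (∈-deduplicate⁺)
open import Data.List.Properties
  using (filter-++; filter-none; length-++; length-map; length-upTo; length-applyUpTo; map-∘)
open import Data.List.Relation.Binary.BagAndSetEquality using (∼bag⇒↭)
open import Data.List.Relation.Binary.Disjoint.Propositional using (Disjoint)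
open import Data.List.Relation.Binary.Permutation.Propositional as ↭ using (_↭_; ↭-sym; ↭⇒↭ₛ)
open import Data.List.Relation.Binary.Permutation.Propositional.Properties using (↭-length)
open import Data.List.Relation.Binary.Permutation.Setoid.Properties using (Unique-resp-↭)
open import Data.List.Relation.Unary.All as All using (All; []; _∷_)
import Data.List.Relation.Unary.All.Properties as All
open import Data.List.Relation.Unary.AllPairs as AllPairs using ()
import Data.List.Relation.Unary.AllPairs.Properties as AllPairs
open import Data.List.Relation.Unary.Any as Any using (here; there; index)
import Data.List.Relation.Unary.Any.Properties as Any
open import Data.List.Relation.Unary.Unique.DecPropositional using (unique?)
open import Data.List.Relation.Unary.Unique.DecSetoid.Properties using (deduplicate-!)
open import Data.List.Relation.Unary.Unique.Propositional using (Unique)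
import Data.List.Relation.Unary.Unique.Propositional.Properties as Unique
import Data.List.Relation.Unary.Unique.Setoid as SetoidUnique
open import Data.Nat
open import Data.Nat.Coprimality
  using (Coprime; coprime?; coprime-divisor; coprime⇒gcd≡1; gcd≡1⇒coprime)
open import Data.Nat.Divisibility
open import Data.Nat.DivMod hiding (m*[n/m]≡n)
open import Data.Nat.GCD
  using (gcd; gcd[m,n]∣m; gcd[m,n]∣n; gcd-greatest; gcd-GCD; c*gcd[m,n]≡gcd[cm,cn]; module Bézout)
open import Data.Nat.Induction using (<-rec)
open import Data.Nat.ListAction using (product)
open import Data.Nat.ListAction.Properties using (∈⇒∣product)
open import Data.Nat.Primality using (Prime; prime⇒nonZero; prime⇒irreducible; ¬prime[1])
open import Data.Nat.Primality.Factorisation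
open import Data.Nat.Properties
open import Data.Nat.Tactic.RingSolver using (solve-∀)
open import Data.Product using (∃; ∃₂; ∃-syntax; _×_; _,_; proj₁; proj₂)
open import Data.Rational as ℚ using ()
open import Data.Rational.Properties using (fromℚᵘ-cong)
open import Data.Rational.Unnormalised using (mkℚᵘ; *≡*)
open import Data.Sum using (inj₁; inj₂; [_,_]′)
open import Data.Vec as Vec using (Vec; []; _∷_; last; lookup; tabulate; take; drop)
import Data.Vec.Functional.Relation.Binary.Equality.Setoid as VectorEquality
open import Data.Vec.Properties
  using (lookup∘tabulate; lookup-++ˡ; lookup-++ʳ; take++drop≡id; tabulate-cong; tabulate∘lookup;
         ∷-injectiveʳ; ≡-dec)
open import Function using (it)
open import Function.Bundles using (Inverse; Equivalence; mk⇔)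
import Function.Construct.Composition as Composition
import Function.Construct.Symmetry as Symmetry
import Function.Endo.Propositional as Endo
open import Level using (0ℓ)
open import Relation.Binary.Bundles using (Setoid; DecSetoid)
import Relation.Binary.Construct.On as On
open import Relation.Binary.Definitions using (tri<; tri≈; tri>)
open import Relation.Binary.Properties.Setoid using (respʳ-flip)
open import Relation.Binary.PropositionalEquality
  using (_≡_; refl; sym; trans; cong; cong₂; cong-app; subst; setoid; _→-setoid_; module ≡-Reasoning)
open import Relation.Nullary using (¬_; Dec; does; yes; no; contradiction; ¬?)
open import Relation.Nullary.Decidable
  using (isYes; toWitness; fromWitness; dec-true; dec-false; does-⇔; toSum; map′; _×-dec_)
open import Relation.Unary using (Decidable)
open import Defs

-- Cardinalities

-- Time is a natural number and is never subtracted from. Since N ≡ 0 modulo m, the value u (t - ℓ)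
-- is written u (r + t), a delay d becomes an advance by N - d, and a congruence modulo n is an
-- equation j * n + s ≡ k * n + t. The rule binds a history only from time N on, and it passes on
-- zeros but says nothing directly about ones. That ones return after N steps as well depends on the
-- assumed period. Steps of ℓ sweep out a whole residue class modulo δ because ℓ / δ is invertible
-- modulo m / δ. M acts on pairs of adjacent letters. The pair 00 cannot occur, and the remaining
-- moves 01 → 10, 01 → 11, 10 → 01, 11 → 10 form a 3 by 3 matrix with characteristic polynomial x³ -
-- x - 1. Its powers 0, 1, 2 have traces 3, 0, 2, the initial values of P. The attractor formulas
-- are obtained as integer identities `sum ≡ + (a * p)`: an orbit of size d has total weight c when
-- each of its elements has weight c / d.

cardinality-unique : ∀ {S j k} → HasCardinality S j → HasCardinality S k → j ≡ k
cardinality-unique f g = ↔⇒≡ (Composition.inverse (Symmetry.inverse f) g)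

cardinality-resp-↔ : ∀ {S T k} → Inverse S T → HasCardinality T k → HasCardinality S k
cardinality-resp-↔ = Composition.inverse

module _ {S : Setoid 0ℓ 0ℓ} where
  open Setoid S using (_≈_; Carrier) renaming (sym to ≈-sym; trans to ≈-trans)
  open SetoidMembership S using () renaming (_∈_ to _∈ₛ_)
  open SetoidUnique S using () renaming (Unique to Uniqueₛ)

  lookup-injective : ∀ {xs} → Uniqueₛ xs → ∀ i j →
                     List.lookup xs i ≈ List.lookup xs j → i ≡ j
  lookup-injective (_   AllPairs.∷ _)  zero    zero    _  = refl
  lookup-injective (x≉s AllPairs.∷ _)  zero    (suc j) eq =
    contradiction eq (All.lookup x≉s (∈-lookup j))
  lookup-injective (x≉s AllPairs.∷ _)  (suc i) zero    eq =
    contradiction (≈-sym eq) (All.lookup x≉s (∈-lookup i))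
  lookup-injective (_   AllPairs.∷ un) (suc i) (suc j) eq = cong suc (lookup-injective un i j eq)

  enumeration⇒cardinality : ∀ {xs} → Uniqueₛ xs → (∀ x → x ∈ₛ xs) → HasCardinality S (length xs)
  enumeration⇒cardinality {xs} un complete = record
    { to        = λ x → index (complete x)
    ; from      = List.lookup xs
    ; to-cong   = λ {x} {y} x≈y → lookup-injective un _ _
        (≈-trans (≈-sym (lookup-complete x)) (≈-trans x≈y (lookup-complete y)))
    ; from-cong = λ { refl → Setoid.refl S }
    ; inverse   =
        (λ {i} {x} x≈ → lookup-injective un _ _ (≈-trans (≈-sym (lookup-complete x)) x≈)) ,
        (λ { {x} refl → ≈-sym (lookup-complete x) })
    }
    where
    lookup-complete : ∀ x → x ≈ List.lookup xs (index (complete x))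
    lookup-complete x = Any.lookup-index (complete x)

funToFin-cong : ∀ {m n} {f g : Fin m → Fin n} → (∀ i → f i ≡ g i) → funToFin f ≡ funToFin g
funToFin-cong {zero}  f≗g = refl
funToFin-cong {suc m} f≗g = cong₂ combine (f≗g zero) (funToFin-cong (λ i → f≗g (suc i)))

Power : Setoid 0ℓ 0ℓ → ℕ → Setoid 0ℓ 0ℓ
Power S d = VectorEquality.≋-setoid S d

cardinality-power : ∀ {S k} d → HasCardinality S k → HasCardinality (Power S d) (k ^ d)
cardinality-power {S} {k} d card = record
  { to        = λ f → funToFin (λ i → C.to (f i))
  ; from      = λ n i → C.from (finToFun n i)
  ; to-cong   = λ f≈g → funToFin-cong (λ i → C.to-cong (f≈g i))
  ; from-cong = λ { refl i → S.refl }
  ; inverse   =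
      (λ {n} f≈ → trans
        (funToFin-cong (λ i → C.inverseˡ (f≈ i)))
        (funToFin-finToFin {d} {k} n)) ,
      (λ { {f} refl i → C.inverseʳ (finToFun-funToFin (λ j → C.to (f j)) i) })
  }
  where
  module S = Setoid S
  module C = Inverse card

-- Configurations and trajectories

periodic-*+ : ∀ {n} {v : ℕ → Bool} → (∀ t → v (n + t) ≡ v t) → ∀ k t → v (k * n + t) ≡ v t
periodic-*+     per zero    t = refl
periodic-*+ {n} {v} per (suc k) t =
  trans (cong v (+-assoc n (k * n) t)) (trans (per (k * n + t)) (periodic-*+ per k t))

nand : Bool → Bool → Bool
nand x y = not x ∨ not y

lookup-ext : ∀ {n} {x y : Vec Bool n} → (∀ i → lookup x i ≡ lookup y i) → x ≡ y
lookup-ext {x = x} {y} x≗y = begin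
  x                   ≡⟨ tabulate∘lookup x ⟨
  tabulate (lookup x) ≡⟨ tabulate-cong x≗y ⟩
  tabulate (lookup y) ≡⟨ tabulate∘lookup y ⟩
  y                   ∎
  where open ≡-Reasoning

last≡lookup : ∀ {n} (x : Vec Bool (suc n)) → last x ≡ lookup x (fromℕ n)
last≡lookup {zero}  (y ∷ []) = refl
last≡lookup {suc n} (y ∷ x)  = last≡lookup x

lookup-take-↑ˡ : ∀ m {n} (x : Vec Bool (m + n)) i → lookup (take m x) i ≡ lookup x (i ↑ˡ n)
lookup-take-↑ˡ m x i = trans
  (sym (lookup-++ˡ (take m x) (drop m x) i))
  (cong (λ y → lookup y (i ↑ˡ _)) (take++drop≡id m x))

lookup-drop-↑ʳ : ∀ m {n} (x : Vec Bool (m + n)) i → lookup (drop m x) i ≡ lookup x (m ↑ʳ i)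
lookup-drop-↑ʳ m x i = trans
  (sym (lookup-++ʳ (take m x) (drop m x) i))
  (cong (λ y → lookup y (m ↑ʳ i)) (take++drop≡id m x))

-- A trajectory is the history of node 0: the states of all nodes are delayed copies of it.
IsTrajectory : (ℓ r m : ℕ) → (ℕ → Bool) → Set
IsTrajectory ℓ r m u = (∀ t → u (m + t) ≡ u t) × (∀ t → u t ≡ nand (u (r + t)) (u (ℓ + t)))

Trajectories : (ℓ r m : ℕ) → Setoid 0ℓ 0ℓ
Trajectories ℓ r m = On.setoid (ℕ →-setoid Bool) (proj₁ {B = IsTrajectory ℓ r m})

module _ (A : Set) where
  open Endo A using (^-homo) renaming (_^_ to _^ᶠ_)

  ^-+ : ∀ (f : A → A) j k x → (f ^ᶠ (j + k)) x ≡ (f ^ᶠ j) ((f ^ᶠ k) x)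
  ^-+ f j k x = cong-app (^-homo f j k) x

  periodic-multiple : ∀ (f : A → A) {p x} → (f ^ᶠ p) x ≡ x → ∀ k → (f ^ᶠ (k * p)) x ≡ x
  periodic-multiple f per zero = refl
  periodic-multiple f {p} {x} per (suc k) = begin
    (f ^ᶠ (p + k * p)) x       ≡⟨ ^-+ f p (k * p) x ⟩
    (f ^ᶠ p) ((f ^ᶠ (k * p)) x) ≡⟨ cong (f ^ᶠ p) (periodic-multiple f per k) ⟩
    (f ^ᶠ p) x                 ≡⟨ per ⟩
    x                         ∎
    where open ≡-Reasoning

  periodic-∣ : ∀ (f : A → A) {p q x} → (f ^ᶠ p) x ≡ x → p ∣ q → (f ^ᶠ q) x ≡ x
  periodic-∣ f per (divides k refl) = periodic-multiple f per k

-- Delays along the two circuits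

module Circuit (a b : ℕ) where

  private
    ℓ = suc a
    r = suc b
    n = ℓ + b

  predecessor : Fin (a + b) → Fin n
  predecessor j = if does (toℕ (suc j) ≟ ℓ) then zero else inject₁ j

  lastˡ : Fin n
  lastˡ = fromℕ a ↑ˡ b

  -- `b` is rebound so that it can be matched on: for a right-circuit of size 1 the last node is
  -- node 0 itself.
  lastʳ : ∀ {b} → Fin (ℓ + b)
  lastʳ {zero}  = zero
  lastʳ {suc b} = ℓ ↑ʳ fromℕ b

  last-leftCircuit : ∀ x → last (leftCircuit ℓ r x) ≡ lookup x lastˡ
  last-leftCircuit x = trans (last≡lookup (take ℓ x)) (lookup-take-↑ˡ ℓ x (fromℕ a))

  last-rightCircuit : ∀ {b} x → last (rightCircuit ℓ (suc b) x) ≡ lookup x lastʳ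
  last-rightCircuit {zero}  (h ∷ x) with drop ℓ (h ∷ x)
  ... | [] = refl
  last-rightCircuit {suc b} x = trans (last≡lookup (drop ℓ x)) (lookup-drop-↑ʳ ℓ x (fromℕ b))

  F-zero : ∀ x → lookup (F ℓ r x) zero ≡ nand (lookup x lastˡ) (lookup x lastʳ)
  F-zero x = cong₂ nand (last-leftCircuit x) (last-rightCircuit x)

  F-suc : ∀ x j → lookup (F ℓ r x) (suc j) ≡ lookup x (predecessor j)
  F-suc x@(_ ∷ _) j = trans (lookup∘tabulate _ j)
    (sym (if-float (lookup x) (does (toℕ (suc j) ≟ ℓ))))

  -- The distance from node 0 along the arcs. Node `ℓ` is fed by node 0 directly, so the count
  -- restarts at 1 on the right-circuit.
  delayAt : ℕ → ℕ
  delayAt k = if does (k <? ℓ) then k else suc (k ∸ ℓ)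

  -- At time t + delay i, node i shows the state of node 0 at time t.
  delay : Fin n → ℕ
  delay i = delayAt (toℕ i)

  delayAt-left : ∀ {k} → k < ℓ → delayAt k ≡ k
  delayAt-left {k} k<ℓ = cong (λ c → if c then k else suc (k ∸ ℓ)) (dec-true (k <? ℓ) k<ℓ)

  delayAt-right : ∀ {k} → ℓ ≤ k → delayAt k ≡ suc (k ∸ ℓ)
  delayAt-right {k} ℓ≤k =
    cong (λ c → if c then k else suc (k ∸ ℓ)) (dec-false (k <? ℓ) (≤⇒≯ ℓ≤k))

  delayAt≤N : ∀ k → k < n → delayAt k ≤ ℓ + r
  delayAt≤N k k<n with k <? ℓ
  ... | yes k<ℓ = ≤-trans (≤-reflexive (delayAt-left k<ℓ)) (≤-trans (<⇒≤ k<ℓ) (m≤m+n ℓ r))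
  ... | no  k≮ℓ = begin
    delayAt k   ≡⟨ delayAt-right (≮⇒≥ k≮ℓ) ⟩
    suc (k ∸ ℓ) ≤⟨ s≤s (m∸n≤m k ℓ) ⟩
    suc k       ≤⟨ k<n ⟩
    ℓ + b       ≤⟨ +-monoʳ-≤ ℓ (n≤1+n b) ⟩
    ℓ + r       ∎
    where open ≤-Reasoning

  delay-zero : ∀ i → delay i ≡ 0 → i ≡ zero
  delay-zero zero    _  = refl
  delay-zero (suc j) eq with suc (toℕ j) <? ℓ
  ... | yes j<ℓ = contradiction (trans (sym (delayAt-left j<ℓ)) eq) 1+n≢0
  ... | no  j≮ℓ = contradiction (trans (sym (delayAt-right (≮⇒≥ j≮ℓ))) eq) 1+n≢0

  -- The irregular case is index `ℓ`, whose predecessor is node 0 and not the node with the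
  -- preceding index.
  delay-suc : ∀ j → delay (suc j) ≡ suc (delay (predecessor j))
  delay-suc j with <-cmp (suc (toℕ j)) ℓ
  ... | tri< j<a j≢a _ = begin
    delay (suc j)              ≡⟨ delayAt-left j<a ⟩
    suc (toℕ j)                ≡⟨ cong suc (delayAt-left (<⇒≤ j<a)) ⟨
    suc (delayAt (toℕ j))      ≡⟨ cong (λ k → suc (delayAt k)) (toℕ-inject₁ j) ⟨
    suc (delay (inject₁ j))    ≡⟨ cong (λ c → suc (delay (if c then zero else inject₁ j)))
                                    (dec-false (suc (toℕ j) ≟ ℓ) j≢a) ⟨
    suc (delay (predecessor j)) ∎
    where open ≡-Reasoning
  ... | tri≈ _ j≡a _ = begin
    delay (suc j)              ≡⟨ delayAt-right (≤-reflexive (sym j≡a)) ⟩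
    suc (suc (toℕ j) ∸ ℓ)      ≡⟨ cong (λ k → suc (k ∸ ℓ)) j≡a ⟩
    suc (ℓ ∸ ℓ)                ≡⟨ cong suc (n∸n≡0 ℓ) ⟩
    suc (delay zero)           ≡⟨ cong (λ c → suc (delay (if c then zero else inject₁ j)))
                                    (dec-true (suc (toℕ j) ≟ ℓ) j≡a) ⟨
    suc (delay (predecessor j)) ∎
    where open ≡-Reasoning
  ... | tri> _ j≢a a<j = begin
    delay (suc j)              ≡⟨ delayAt-right (<⇒≤ a<j) ⟩
    suc (toℕ j ∸ a)            ≡⟨ cong suc (+-∸-assoc 1 (s≤s⁻¹ a<j)) ⟩
    suc (suc (toℕ j ∸ ℓ))      ≡⟨ cong suc (delayAt-right (s≤s⁻¹ a<j)) ⟨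
    suc (delayAt (toℕ j))      ≡⟨ cong (λ k → suc (delayAt k)) (toℕ-inject₁ j) ⟨
    suc (delay (inject₁ j))    ≡⟨ cong (λ c → suc (delay (if c then zero else inject₁ j)))
                                    (dec-false (suc (toℕ j) ≟ ℓ) j≢a) ⟨
    suc (delay (predecessor j)) ∎
    where open ≡-Reasoning

  delay-lastˡ : delay lastˡ ≡ a
  delay-lastˡ = trans (cong delayAt toℕ-lastˡ) (delayAt-left ≤-refl)
    where
    toℕ-lastˡ : toℕ lastˡ ≡ a
    toℕ-lastˡ = trans (toℕ-↑ˡ (fromℕ a) b) (toℕ-fromℕ a)

  delay-lastʳ : ∀ {b} → delayAt (toℕ (lastʳ {b})) ≡ b
  delay-lastʳ {zero}  = refl
  delay-lastʳ {suc b} = begin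
    delayAt (toℕ (ℓ ↑ʳ fromℕ b)) ≡⟨ cong delayAt (trans (toℕ-↑ʳ ℓ (fromℕ b))
                                       (cong (λ x → ℓ + x) (toℕ-fromℕ b))) ⟩
    delayAt (ℓ + b)              ≡⟨ delayAt-right (m≤m+n ℓ b) ⟩
    suc (ℓ + b ∸ ℓ)              ≡⟨ cong suc (m+n∸m≡n ℓ b) ⟩
    suc b                        ∎
    where open ≡-Reasoning

  private
    N = ℓ + r
    Fⁿ = F^ ℓ r

  history : Config ℓ r → ℕ → Bool
  history x t = lookup (Fⁿ t x) zero

  -- Undoing one application of `F` moves one arc back towards node 0. The delay is a separate
  -- argument `d` so that this recursion is structural.
  lookup-F^ : ∀ x d t i → delay i ≡ d → lookup (Fⁿ (d + t) x) i ≡ history x t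
  lookup-F^ x zero    t i       eq rewrite delay-zero i eq = refl
  lookup-F^ x (suc d) t zero    ()
  lookup-F^ x (suc d) t (suc j) eq = trans
    (F-suc (Fⁿ (d + t) x) j)
    (lookup-F^ x d t (predecessor j) (suc-injective (trans (sym (delay-suc j)) eq)))

  -- Node 0 at time N + t is computed from the two last nodes at time N - 1 + t. Their delays ℓ - 1
  -- and r - 1 leave the times r + t and ℓ + t.
  history-rule : ∀ x t → history x (N + t) ≡ nand (history x (r + t)) (history x (ℓ + t))
  history-rule x t = begin
    lookup (F ℓ r (Fⁿ (a + r + t) x)) zero
      ≡⟨ F-zero (Fⁿ (a + r + t) x) ⟩
    nand (lookup (Fⁿ (a + r + t) x) lastˡ) (lookup (Fⁿ (a + r + t) x) lastʳ)
      ≡⟨ cong₂ (λ j k → nand (lookup (Fⁿ j x) lastˡ) (lookup (Fⁿ k x) lastʳ)) eqˡ eqʳ ⟩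
    nand (lookup (Fⁿ (a + (r + t)) x) lastˡ) (lookup (Fⁿ (b + (ℓ + t)) x) lastʳ)
      ≡⟨ cong₂ nand (lookup-F^ x a (r + t) lastˡ delay-lastˡ) (lookup-F^ x b (ℓ + t) lastʳ delay-lastʳ) ⟩
    nand (history x (r + t)) (history x (ℓ + t)) ∎
    where
    open ≡-Reasoning
    eqˡ : a + r + t ≡ a + (r + t)
    eqˡ = +-assoc a r t
    eqʳ : a + r + t ≡ b + (ℓ + t)
    eqʳ = trans (cong (_+ t) (trans (+-suc a b) (+-comm ℓ b))) (+-assoc b ℓ t)

  history-periodic : ∀ {m x} → HasPeriod ℓ r m x → ∀ t → history x (m + t) ≡ history x t
  history-periodic {m} {x} per t = begin
    history x (m + t)                 ≡⟨ cong (history x) (+-comm m t) ⟩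
    history x (t + m)                 ≡⟨ cong (λ y → lookup y zero) (^-+ _ (F ℓ r) t m x) ⟩
    history (Fⁿ m x) t                ≡⟨ cong (λ y → history y t) per ⟩
    history x t                       ∎
    where open ≡-Reasoning

  -- Under period N, going back `delay i` steps amounts to going forward `codelay i` steps, so a
  -- configuration can be rebuilt from `u` at times that are never negative.
  codelay : Fin n → ℕ
  codelay i = N ∸ delay i

  delay≤N : ∀ i → delay i ≤ N
  delay≤N i = delayAt≤N (toℕ i) (toℕ<n i)

  delay+codelay : ∀ i → delay i + codelay i ≡ N
  delay+codelay i = m+[n∸m]≡n (delay≤N i)

  codelay-predecessor : ∀ j → codelay (predecessor j) ≡ suc (codelay (suc j))
  codelay-predecessor j = begin
    N ∸ delay (predecessor j)           ≡⟨⟩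
    suc N ∸ suc (delay (predecessor j)) ≡⟨ cong (suc N ∸_) (delay-suc j) ⟨
    suc N ∸ delay (suc j)               ≡⟨ +-∸-assoc 1 (delay≤N (suc j)) ⟩
    suc (codelay (suc j))               ∎
    where open ≡-Reasoning

  codelay-lastˡ : codelay lastˡ ≡ suc r
  codelay-lastˡ = begin
    N ∸ delay lastˡ ≡⟨ cong (N ∸_) delay-lastˡ ⟩
    suc a + r ∸ a   ≡⟨ cong (_∸ a) (+-suc a r) ⟨
    a + suc r ∸ a   ≡⟨ m+n∸m≡n a (suc r) ⟩
    suc r           ∎
    where open ≡-Reasoning

  codelay-lastʳ : codelay lastʳ ≡ suc ℓ
  codelay-lastʳ = begin
    N ∸ delay lastʳ ≡⟨ cong (N ∸_) (delay-lastʳ {b}) ⟩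
    ℓ + suc b ∸ b   ≡⟨ cong (_∸ b) (+-suc ℓ b) ⟩
    suc ℓ + b ∸ b   ≡⟨ m+n∸n≡m (suc ℓ) b ⟩
    suc ℓ           ∎
    where open ≡-Reasoning

  config : (ℕ → Bool) → ℕ → Config ℓ r
  config u t = tabulate (λ i → u (codelay i + t))

  lookup-config : ∀ u t i → lookup (config u t) i ≡ u (codelay i + t)
  lookup-config u t i = lookup∘tabulate (λ i → u (codelay i + t)) i

  periodic-+ : ∀ {m} {u : ℕ → Bool} → (∀ t → u (m + t) ≡ u t) → m ∣ N → ∀ t → u (N + t) ≡ u t
  periodic-+ {u = u} per (divides k N≡k*m) t = trans (cong (λ s → u (s + t)) N≡k*m) (periodic-*+ per k t)

  module _ {m : ℕ} (m∣N : m ∣ N) where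

    trajectory : ∀ {x} → HasPeriod ℓ r m x → IsTrajectory ℓ r m (history x)
    trajectory {x} per =
      history-periodic {m} per ,
      -- The rule yields the value at N + t, which is the value at t because m divides N.
      λ t → trans (sym (periodic-+ {u = history x} (history-periodic {m} per) m∣N t)) (history-rule x t)

    module _ {u : ℕ → Bool} (tr : IsTrajectory ℓ r m u) where

      private
        per  = proj₁ tr
        rule = proj₂ tr

      F-config : ∀ t → F ℓ r (config u t) ≡ config u (suc t)
      F-config t = lookup-ext step
        where
        open ≡-Reasoning
        step : ∀ i → lookup (F ℓ r (config u t)) i ≡ lookup (config u (suc t)) i
        -- `codelay zero` is N, so node 0 of `config u t` shows `u` one lap of N ahead.
        step zero = begin
          lookup (F ℓ r (config u t)) zero
            ≡⟨ F-zero (config u t) ⟩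
          nand (lookup (config u t) lastˡ) (lookup (config u t) lastʳ)
            ≡⟨ cong₂ nand (lookup-config u t lastˡ) (lookup-config u t lastʳ) ⟩
          nand (u (codelay lastˡ + t)) (u (codelay lastʳ + t))
            ≡⟨ cong₂ (λ j k → nand (u j) (u k))
                 (trans (cong (_+ t) codelay-lastˡ) (sym (+-suc r t)))
                 (trans (cong (_+ t) codelay-lastʳ) (sym (+-suc ℓ t))) ⟩
          nand (u (r + suc t)) (u (ℓ + suc t))
            ≡⟨ rule (suc t) ⟨
          u (suc t)
            ≡⟨ periodic-+ {u = u} per m∣N (suc t) ⟨
          u (N + suc t) ∎
        step (suc j) = begin
          lookup (F ℓ r (config u t)) (suc j)   ≡⟨ F-suc (config u t) j ⟩
          lookup (config u t) (predecessor j)   ≡⟨ lookup-config u t (predecessor j) ⟩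
          u (codelay (predecessor j) + t)       ≡⟨ cong (λ k → u (k + t)) (codelay-predecessor j) ⟩
          u (suc (codelay (suc j)) + t)         ≡⟨ cong u (+-suc (codelay (suc j)) t) ⟨
          u (codelay (suc j) + suc t)           ≡⟨ lookup-config u (suc t) (suc j) ⟨
          lookup (config u (suc t)) (suc j)     ∎

      F^-config : ∀ t → Fⁿ t (config u 0) ≡ config u t
      F^-config zero    = refl
      F^-config (suc t) = trans (cong (F ℓ r) (F^-config t)) (F-config t)

      config-periodic : HasPeriod ℓ r m (config u 0)
      config-periodic = trans (F^-config m) (tabulate-cong (λ i →
        trans (cong u (trans (+-comm (codelay i) m) (cong (λ x → m + x) (sym (+-identityʳ (codelay i))))))
              (per (codelay i + 0))))

      history-config : ∀ t → history (config u 0) t ≡ u t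
      history-config t = trans
        (cong (λ x → lookup x zero) (F^-config t))
        (periodic-+ {u = u} per m∣N t)

    config-history : ∀ {x} → HasPeriod ℓ r m x → config (history x) 0 ≡ x
    config-history {x} per = lookup-ext λ i → begin
      lookup (config (history x) 0) i             ≡⟨ lookup-config (history x) 0 i ⟩
      history x (codelay i + 0)                   ≡⟨ cong (history x) (+-identityʳ (codelay i)) ⟩
      history x (codelay i)                       ≡⟨ lookup-F^ x (delay i) (codelay i) i refl ⟨
      lookup (Fⁿ (delay i + codelay i) x) i       ≡⟨ cong (λ k → lookup (Fⁿ k x) i) (delay+codelay i) ⟩
      lookup (Fⁿ N x) i                           ≡⟨ cong (λ y → lookup y i) (periodic-∣ _ (F ℓ r) {p = m} per m∣N) ⟩
      lookup x i                                  ∎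
      where open ≡-Reasoning

    periodicConfigs↔trajectories : Inverse (PeriodicConfigs ℓ r m) (Trajectories ℓ r m)
    periodicConfigs↔trajectories = record
      { to        = λ (x , per) → history x , trajectory per
      ; from      = λ (u , tr) → config u 0 , config-periodic tr
      ; to-cong   = λ { refl t → refl }
      ; from-cong = λ u≗v → tabulate-cong (λ i → u≗v (codelay i + 0))
      ; inverse   =
          (λ { {u , tr} refl t → history-config tr t }) ,
          (λ {(x , per)} u≗ → trans (tabulate-cong (λ i → u≗ (codelay i + 0))) (config-history per))
      }

  -- Propagation of zeros and the period N

  -- A zero at s forces ones at s + ℓ and s + r, hence a zero at s + N.
  false-persists : ∀ x t → history x (N + t) ≡ false → history x (N + (N + t)) ≡ false
  false-persists x t z =
    trans (history-rule x (N + t)) (cong₂ nand one-r one-ℓ)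
    where
    open ≡-Reasoning
    u = history x

    nand-falseʳ : ∀ c {d} → d ≡ false → nand c d ≡ true
    nand-falseʳ true  refl = refl
    nand-falseʳ false refl = refl

    one-r : u (r + (N + t)) ≡ true
    one-r = begin
      u (r + (N + t))                             ≡⟨ cong u (x∙yz≈y∙xz +-commutativeSemigroup r N t) ⟩
      u (N + (r + t))                             ≡⟨ history-rule x (r + t) ⟩
      nand (u (r + (r + t))) (u (ℓ + (r + t)))    ≡⟨ nand-falseʳ (u (r + (r + t)))
                                                       (trans (cong u (sym (+-assoc ℓ r t))) z) ⟩
      true                                        ∎

    one-ℓ : u (ℓ + (N + t)) ≡ true
    one-ℓ = begin
      u (ℓ + (N + t))                             ≡⟨ cong u (x∙yz≈y∙xz +-commutativeSemigroup ℓ N t) ⟩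
      u (N + (ℓ + t))                             ≡⟨ history-rule x (ℓ + t) ⟩
      nand (u (r + (ℓ + t))) (u (ℓ + (ℓ + t)))    ≡⟨ cong (λ c → nand c (u (ℓ + (ℓ + t))))
                                                       (trans (cong u (trans (x∙yz≈y∙xz +-commutativeSemigroup r ℓ t)
                                                                     (sym (+-assoc ℓ r t)))) z) ⟩
      true                                        ∎

  module _ {p : ℕ} {x : Config ℓ r} .{{_ : NonZero p}} (per : HasPeriod ℓ r p x) where

    private
      u = history x

      u-multiple : ∀ k t → u (k * p + t) ≡ u t
      u-multiple k t = history-periodic {m = k * p} (periodic-multiple _ (F ℓ r) {p = p} per k) t

    -- `false-persists` speaks only of times from N on. A shift by `N * p`, a multiple of the
    -- period, moves any t into that range.
    false-forward : ∀ t → u t ≡ false → u (N + t) ≡ false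
    false-forward t z = begin
      u (N + t)                     ≡⟨ u-multiple N (N + t) ⟨
      u (N * p + (N + t))           ≡⟨ cong u eq ⟩
      u (N + (N + t′))              ≡⟨ false-persists x t′ (trans (cong u eq′) (trans (u-multiple N t) z)) ⟩
      false                         ∎
      where
      open ≡-Reasoning
      t′ = N * p ∸ N + t
      eq′ : N + t′ ≡ N * p + t
      eq′ = trans (sym (+-assoc N (N * p ∸ N) t)) (cong (_+ t) (m+[n∸m]≡n (m≤m*n N p)))
      eq : N * p + (N + t) ≡ N + (N + t′)
      eq = trans (sym (+-assoc (N * p) N t)) (trans (cong (_+ t) (+-comm (N * p) N))
        (trans (+-assoc N (N * p) t) (cong (λ x → N + x) (sym eq′))))

    false-multiple : ∀ k t → u t ≡ false → u (k * N + t) ≡ false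
    false-multiple zero    t z = z
    false-multiple (suc k) t z =
      trans (cong u (+-assoc N (k * N) t)) (false-forward (k * N + t) (false-multiple k t z))

    -- If a one at t were followed by a zero at N + t, that zero would be passed on through p - 1
    -- further laps to p * N + t, where the period p shows the one again.
    history-+N : ∀ t → u (N + t) ≡ u t
    history-+N t with u t in z
    ... | false = false-forward t z
    ... | true  with u (N + t) in z′
    ...   | true  = refl
    ...   | false = contradiction (trans (sym z) (trans (sym around) (false-multiple (pred p) (N + t) z′))) λ ()
      where
      around : u (pred p * N + (N + t)) ≡ u t
      around = trans
        (cong u (begin
          pred p * N + (N + t)  ≡⟨ +-assoc (pred p * N) N t ⟨
          pred p * N + N + t    ≡⟨ cong (_+ t) (+-comm (pred p * N) N) ⟩
          suc (pred p) * N + t  ≡⟨ cong (λ k → k * N + t) (suc-pred p) ⟩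
          p * N + t             ≡⟨ cong (_+ t) (*-comm p N) ⟩
          N * p + t             ∎))
        (u-multiple N t)
        where open ≡-Reasoning

    -- `x` recurs at time N * p, late enough for every node to show a state that node 0 had at some
    -- time t ≥ 0. This reduces the claim to node 0.
    periodic⇒period-N : HasPeriod ℓ r N x
    periodic⇒period-N = lookup-ext λ i → begin
      lookup (Fⁿ N x) i                            ≡⟨ cong (λ y → lookup (Fⁿ N y) i) x-far ⟨
      lookup (Fⁿ N (Fⁿ (N * p) x)) i               ≡⟨ cong (λ y → lookup y i) (^-+ _ (F ℓ r) N (N * p) x) ⟨
      lookup (Fⁿ (N + N * p) x) i                  ≡⟨ cong (λ k → lookup (Fⁿ k x) i) (eqN i) ⟩
      lookup (Fⁿ (delay i + (N + t i)) x) i        ≡⟨ lookup-F^ x (delay i) (N + t i) i refl ⟩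
      u (N + t i)                                  ≡⟨ history-+N (t i) ⟩
      u (t i)                                      ≡⟨ lookup-F^ x (delay i) (t i) i refl ⟨
      lookup (Fⁿ (delay i + t i) x) i              ≡⟨ cong (λ k → lookup (Fⁿ k x) i) (eq i) ⟩
      lookup (Fⁿ (N * p) x) i                      ≡⟨ cong (λ y → lookup y i) x-far ⟩
      lookup x i                                   ∎
      where
      open ≡-Reasoning
      x-far : Fⁿ (N * p) x ≡ x
      x-far = periodic-multiple _ (F ℓ r) {p = p} per N
      t : Fin n → ℕ
      t i = N * p ∸ delay i
      eq : ∀ i → delay i + t i ≡ N * p
      eq i = m+[n∸m]≡n (≤-trans (delay≤N i) (m≤m*n N p))
      eqN : ∀ i → N + N * p ≡ delay i + (N + t i)
      eqN i = trans (cong (λ x → N + x) (sym (eq i)))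
        (trans (sym (+-assoc N (delay i) (t i)))
          (trans (cong (_+ t i) (+-comm N (delay i))) (+-assoc (delay i) N (t i))))

-- Cyclic words

map-proj₁-toList : {X : Set} {P : X → Set} {xs : List X} (pxs : All P xs) → map proj₁ (All.toList pxs) ≡ xs
map-proj₁-toList []         = refl
map-proj₁-toList (px ∷ pxs) = cong (_ ∷_) (map-proj₁-toList pxs)

module _ {X : Set} {P : X → Set} (P? : Decidable P) (xs : List X) where

  subtype : List (∃ P)
  subtype = All.toList (All.all-filter P? xs)

  map-proj₁-subtype : map proj₁ subtype ≡ filter P? xs
  map-proj₁-subtype = map-proj₁-toList (All.all-filter P? xs)

  module _ (complete : ∀ x → x ∈ xs) where

    subtype-complete : ∀ (x : ∃ P) → Any.Any (λ y → proj₁ x ≡ proj₁ y) subtype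
    subtype-complete (x , px) =
      Any.map⁻ (subst (x ∈_) (sym map-proj₁-subtype) (∈-filter⁺ P? (complete x) px))

    subtype-cardinality : Unique xs →
      HasCardinality (On.setoid (setoid X) (proj₁ {B = P})) (length (filter P? xs))
    subtype-cardinality un = subst (HasCardinality _) length-subtype
      (enumeration⇒cardinality
        (AllPairs.map⁻ (subst Unique (sym map-proj₁-subtype) (Unique.filter⁺ P? un)))
        subtype-complete)
      where
      length-subtype : length subtype ≡ length (filter P? xs)
      length-subtype = trans (sym (length-map proj₁ subtype)) (cong length map-proj₁-subtype)

words : ∀ n → List (Vec Bool n)
words zero    = [] ∷ []
words (suc n) = map (false ∷_) (words n) ++ map (true ∷_) (words n)

words-complete : ∀ {n} (w : Vec Bool n) → w ∈ words n
words-complete []          = here refl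
words-complete (false ∷ w) = ∈-++⁺ˡ (∈-map⁺ (false ∷_) (words-complete w))
words-complete (true ∷ w)  = ∈-++⁺ʳ _ (∈-map⁺ (true ∷_) (words-complete w))

words-unique : ∀ n → Unique (words n)
words-unique zero    = [] AllPairs.∷ AllPairs.[]
words-unique (suc n) = Unique.++⁺
  (Unique.map⁺ ∷-injectiveʳ (words-unique n))
  (Unique.map⁺ ∷-injectiveʳ (words-unique n))
  disjoint
  where
  disjoint : ∀ {w} → ¬ (w ∈ map (false ∷_) (words n) × w ∈ map (true ∷_) (words n))
  disjoint (w∈f , w∈t) with ∈-map⁻ _ w∈f | ∈-map⁻ _ w∈t
  ... | _ , _ , refl | _ , _ , ()

-- The transfer-matrix count

count : ∀ n → (Vec Bool n → Bool) → ℕ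
count n p = length (filter (λ w → T? (p w)) (words n))

length-filter-map : {X Y : Set} (p : Y → Bool) (f : X → Y) (xs : List X) →
  length (filter (λ y → T? (p y)) (map f xs)) ≡ length (filter (λ x → T? (p (f x))) xs)
length-filter-map p f []       = refl
length-filter-map p f (x ∷ xs) with p (f x)
... | true  = cong suc (length-filter-map p f xs)
... | false = length-filter-map p f xs

count-suc : ∀ n p → count (suc n) p ≡ count n (λ w → p (false ∷ w)) + count n (λ w → p (true ∷ w))
count-suc n p = begin
  length (filter p? (ws₀ ++ ws₁))                ≡⟨ cong length (filter-++ p? ws₀ ws₁) ⟩
  length (filter p? ws₀ ++ filter p? ws₁)        ≡⟨ length-++ (filter p? ws₀) ⟩
  length (filter p? ws₀) + length (filter p? ws₁) ≡⟨ cong₂ _+_ (length-filter-map p _ (words n))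
                                                                 (length-filter-map p _ (words n)) ⟩
  count n (λ w → p (false ∷ w)) + count n (λ w → p (true ∷ w)) ∎
  where
  open ≡-Reasoning
  p?  = λ w → T? (p w)
  ws₀ = map (false ∷_) (words n)
  ws₁ = map (true ∷_) (words n)

count-false : ∀ n → count n (λ _ → false) ≡ 0
count-false n = cong length (filter-none (λ _ → T? false) {words n} (All.universal (λ _ ()) (words n)))

-- fits a b w c d: the rule holds at every interior letter of the word a b w c d.
triple : Bool → Bool → Bool → Bool
triple x y z = isYes (y ≟ᵇ nand x z)

fits : ∀ {k} → Bool → Bool → Vec Bool k → Bool → Bool → Bool
fits a b []      c d = triple a b c ∧ triple b c d
fits a b (e ∷ w) c d = triple a b e ∧ fits b e w c d

closed : ∀ {k} → Vec Bool (2 + k) → Bool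
closed (a ∷ b ∷ w) = fits a b w a b

-- The entry of M^(k + 2) at row ab and column cd: the whole word has k + 4 letters, hence k + 2
-- interior ones, each accounting for one move of the window of two letters.
fillings : ℕ → Bool → Bool → Bool → Bool → ℕ
fillings k a b c d = count k (λ w → fits a b w c d)

-- The second letter would have to be the nand of a zero with something, which is a one.
fillings-00 : ∀ k c d → fillings k false false c d ≡ 0
fillings-00 zero    false d = refl
fillings-00 zero    true  d = refl
fillings-00 (suc k) c     d = trans (count-suc k _) (cong₂ _+_ (count-false k) (count-false k))

-- Row expansion of M. From 01 the window may move to 10 or 11; the next two lemmas record that it
-- moves from 10 only to 01 and from 11 only to 10.
fillings-01 : ∀ k c d → fillings (suc k) false true c d ≡ fillings k true false c d + fillings k true true c d
fillings-01 k c d = count-suc k _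

fillings-10 : ∀ k c d → fillings (suc k) true false c d ≡ fillings k false true c d
fillings-10 k c d = trans (count-suc k _) (cong (_+ fillings k false true c d) (count-false k))

fillings-11 : ∀ k c d → fillings (suc k) true true c d ≡ fillings k true false c d
fillings-11 k c d = trans (count-suc k _)
  (trans (cong (λ x → fillings k true false c d + x) (count-false k)) (+-identityʳ _))

-- The transfer matrix M of the rule satisfies M³ = M + 1.
fillings-+3 : ∀ k a b c d → fillings (3 + k) a b c d ≡ fillings (1 + k) a b c d + fillings k a b c d
fillings-+3 k false false c d = trans (fillings-00 (3 + k) c d)
  (sym (cong₂ _+_ (fillings-00 (1 + k) c d) (fillings-00 k c d)))
fillings-+3 k false true c d = begin
  fillings (3 + k) false true c d
    ≡⟨ fillings-01 (2 + k) c d ⟩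
  fillings (2 + k) true false c d + fillings (2 + k) true true c d
    ≡⟨ cong₂ _+_ (fillings-10 (1 + k) c d) (trans (fillings-11 (1 + k) c d) (fillings-10 k c d)) ⟩
  fillings (1 + k) false true c d + fillings k false true c d ∎
  where open ≡-Reasoning
fillings-+3 k true false c d = begin
  fillings (3 + k) true false c d
    ≡⟨ trans (fillings-10 (2 + k) c d) (fillings-01 (1 + k) c d) ⟩
  fillings (1 + k) true false c d + fillings (1 + k) true true c d
    ≡⟨ cong (λ x → fillings (1 + k) true false c d + x) (fillings-11 k c d) ⟩
  fillings (1 + k) true false c d + fillings k true false c d ∎
  where open ≡-Reasoning
fillings-+3 k true true c d = begin
  fillings (3 + k) true true c d
    ≡⟨ trans (fillings-11 (2 + k) c d) (trans (fillings-10 (1 + k) c d) (fillings-01 k c d)) ⟩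
  fillings k true false c d + fillings k true true c d
    ≡⟨ cong (_+ fillings k true true c d) (fillings-11 k c d) ⟨
  fillings (1 + k) true true c d + fillings k true true c d ∎
  where open ≡-Reasoning

-- The trace of M^(k + 2): a word of k + 2 letters is closed into a cycle by repeating its first two
-- letters at the end.
trace : ℕ → ℕ
trace k = (fillings k false false false false + fillings k false true false true)
        + (fillings k true false true false + fillings k true true true true)

trace-+3 : ∀ k → trace (3 + k) ≡ trace (1 + k) + trace k
trace-+3 k = begin
  trace (3 + k)
    ≡⟨ cong₂ _+_
         (cong₂ _+_ (fillings-+3 k false false false false) (fillings-+3 k false true false true))
         (cong₂ _+_ (fillings-+3 k true false true false) (fillings-+3 k true true true true)) ⟩
  _
    ≡⟨ cong₂ _+_ (+-interchange f₀₀ _ f₀₁ _) (+-interchange f₁₀ _ f₁₁ _) ⟩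
  _
    ≡⟨ +-interchange (f₀₀ + f₀₁) _ (f₁₀ + f₁₁) _ ⟩
  trace (1 + k) + trace k ∎
  where
  open ≡-Reasoning
  +-interchange = interchange +-commutativeSemigroup
  f₀₀ = fillings (1 + k) false false false false
  f₀₁ = fillings (1 + k) false true false true
  f₁₀ = fillings (1 + k) true false true false
  f₁₁ = fillings (1 + k) true true true true

count-closed : ∀ k → count (2 + k) closed ≡ perrin (2 + k)
count-closed k = trans count≡trace (trace≡perrin k)
  where
  count≡trace : count (2 + k) closed ≡ trace k
  count≡trace = trans (count-suc (suc k) closed) (cong₂ _+_ (count-suc k _) (count-suc k _))
  trace≡perrin : ∀ k → trace k ≡ perrin (2 + k)
  -- The traces of M², M³ and M⁴ are 2, 3 and 2, found by enumeration.
  trace≡perrin 0 = refl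
  trace≡perrin 1 = refl
  trace≡perrin 2 = refl
  trace≡perrin (suc (suc (suc k))) =
    trans (trace-+3 k) (cong₂ _+_ (trace≡perrin (suc k)) (trace≡perrin k))

-- Cyclic words as periodic sequences

periodic-% : ∀ {n} .{{_ : NonZero n}} {v : ℕ → Bool} → (∀ t → v (n + t) ≡ v t) →
             ∀ j t → v (j + t % n) ≡ v (j + t)
periodic-% {n} {v} per j t = begin
  v (j + t % n)               ≡⟨ periodic-*+ per (t / n) (j + t % n) ⟨
  v (t / n * n + (j + t % n)) ≡⟨ cong v (+-comm (t / n * n) _) ⟩
  v (j + t % n + t / n * n)   ≡⟨ cong v (+-assoc j _ _) ⟩
  v (j + (t % n + t / n * n)) ≡⟨ cong (λ s → v (j + s)) (m≡m%n+[m/n]*n t n) ⟨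
  v (j + t)                   ∎
  where open ≡-Reasoning

toℕ-mod : ∀ {δ} .{{_ : NonZero δ}} (i : Fin δ) → toℕ i mod δ ≡ i
toℕ-mod i = trans (fromℕ<-cong _ _ (m<n⇒m%n≡m (toℕ<n i)) _ (toℕ<n i)) (fromℕ<-toℕ i (toℕ<n i))

IsCyclicWord : ℕ → (ℕ → Bool) → Set
IsCyclicWord n v = (∀ t → v (n + t) ≡ v t) × (∀ t → v (1 + t) ≡ nand (v t) (v (2 + t)))

CyclicWords : ℕ → Setoid 0ℓ 0ℓ
CyclicWords n = On.setoid (ℕ →-setoid Bool) (proj₁ {B = IsCyclicWord n})

prefix : ∀ k → (ℕ → Bool) → Vec Bool k
prefix k v = tabulate (λ i → v (toℕ i))

fits⁺ : ∀ k v → (∀ t → v (1 + t) ≡ nand (v t) (v (2 + t))) →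
        T (fits (v 0) (v 1) (prefix k (λ t → v (2 + t))) (v (2 + k)) (v (3 + k)))
fits⁺ zero    v rule = Equivalence.from (T-∧ {triple (v 0) (v 1) (v 2)})
  (fromWitness (rule 0) , fromWitness {a? = v 2 ≟ᵇ nand (v 1) (v 3)} (rule 1))
fits⁺ (suc k) v rule = Equivalence.from (T-∧ {triple (v 0) (v 1) (v 2)})
  (fromWitness (rule 0) , fits⁺ k (λ t → v (1 + t)) (λ t → rule (1 + t)))

-- The bound 2 + k is the number of interior letters and also the length of the cycle, so one full
-- period of the rule is recovered; `closed⁻` extends it by periodicity.
fits⁻ : ∀ k v → T (fits (v 0) (v 1) (prefix k (λ t → v (2 + t))) (v (2 + k)) (v (3 + k))) →
        ∀ t → t < 2 + k → v (1 + t) ≡ nand (v t) (v (2 + t))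
fits⁻ zero    v ok t t<2 with Equivalence.to (T-∧ {triple (v 0) (v 1) (v 2)}) ok
fits⁻ zero    v ok 0 _ | ok₀ , _   = toWitness ok₀
fits⁻ zero    v ok 1 _ | _   , ok₁ = toWitness {a? = v 2 ≟ᵇ nand (v 1) (v 3)} ok₁
fits⁻ zero    v ok (suc (suc t)) (s≤s (s≤s ())) | _
fits⁻ (suc k) v ok t t<k with Equivalence.to (T-∧ {triple (v 0) (v 1) (v 2)}) ok
fits⁻ (suc k) v ok zero    _   | ok₀ , _    = toWitness ok₀
fits⁻ (suc k) v ok (suc t) t<k | _   , ok₊ = fits⁻ k (λ t → v (1 + t)) ok₊ t (s≤s⁻¹ t<k)

module _ (k : ℕ) where
  private
    n = 2 + k

  repeat : Vec Bool n → ℕ → Bool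
  repeat w t = lookup w (t mod n)

  repeat-periodic : ∀ w t → repeat w (n + t) ≡ repeat w t
  repeat-periodic w t = cong (lookup w) (fromℕ<-cong _ _
    (trans (cong (_% n) (+-comm n t)) ([m+n]%n≡m%n t n)) _ _)

  repeat-prefix : ∀ {v} → (∀ t → v (n + t) ≡ v t) → ∀ t → repeat (prefix n v) t ≡ v t
  repeat-prefix {v} per t = begin
    lookup (prefix n v) (t mod n) ≡⟨ lookup∘tabulate (λ i → v (toℕ i)) (t mod n) ⟩
    v (toℕ (t mod n))             ≡⟨ cong v (toℕ-fromℕ< (m%n<n t n)) ⟩
    v (t % n)                     ≡⟨ periodic-% per 0 t ⟩
    v t                           ∎
    where open ≡-Reasoning

  prefix-repeat : ∀ w → prefix n (repeat w) ≡ w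
  prefix-repeat w = trans (tabulate-cong λ i → cong (lookup w) (toℕ-mod i)) (tabulate∘lookup w)

  -- Periodicity identifies the letters at n and n + 1 with the first two, which turns the cyclic
  -- condition into one on a linear word.
  wrap : ∀ {v} → (∀ t → v (n + t) ≡ v t) →
    closed (prefix n v) ≡ fits (v 0) (v 1) (prefix k (λ t → v (2 + t))) (v (2 + k)) (v (3 + k))
  wrap {v} per = cong₂ (fits (v 0) (v 1) (prefix k (λ t → v (2 + t))))
    (trans (sym (per 0)) (cong v (+-identityʳ n)))
    (trans (sym (per 1)) (cong v (+-comm n 1)))

  closed⁺ : ∀ {v} → IsCyclicWord n v → T (closed (prefix n v))
  closed⁺ {v} (per , rule) = subst T (sym (wrap per)) (fits⁺ k v rule)

  closed⁻ : ∀ w → T (closed w) → IsCyclicWord n (repeat w)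
  closed⁻ w ok = per , λ t → begin
    v (1 + t)                         ≡⟨ periodic-% per 1 t ⟨
    v (1 + t % n)                     ≡⟨ local (t % n) (m%n<n t n) ⟩
    nand (v (t % n)) (v (2 + t % n))  ≡⟨ cong₂ nand (periodic-% per 0 t) (periodic-% per 2 t) ⟩
    nand (v t) (v (2 + t))            ∎
    where
    open ≡-Reasoning
    v : ℕ → Bool
    v = repeat w
    per : ∀ t → v (n + t) ≡ v t
    per = repeat-periodic w
    local : ∀ t → t < n → v (1 + t) ≡ nand (v t) (v (2 + t))
    local = fits⁻ k v (subst T (trans (cong closed (sym (prefix-repeat w))) (wrap per)) ok)

  cyclicWords↔closed :
    Inverse (CyclicWords n) (On.setoid (setoid (Vec Bool n)) (proj₁ {B = λ w → T (closed w)}))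
  cyclicWords↔closed = record
    { to        = λ (v , cyc) → prefix n v , closed⁺ cyc
    ; from      = λ (w , ok) → repeat w , closed⁻ w ok
    ; to-cong   = λ v≗ → tabulate-cong (λ i → v≗ (toℕ i))
    ; from-cong = λ { refl t → refl }
    ; inverse   =
        (λ {(w , _)} v≗ → trans (tabulate-cong (λ i → v≗ (toℕ i))) (prefix-repeat w)) ,
        (λ { {v , per , _} refl → repeat-prefix per })
    }

nand-irreflexive : ∀ c → ¬ (c ≡ nand c c)
nand-irreflexive true  ()
nand-irreflexive false ()

cyclicWords-cardinality : ∀ n .{{_ : NonZero n}} → HasCardinality (CyclicWords n) (perrin n)
-- In a cycle of length 1 the only letter is both of its own neighbours and would equal its nand
-- with itself, in accordance with P(1) = 0.
cyclicWords-cardinality (suc zero) = enumeration⇒cardinality {xs = []} AllPairs.[] λ where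
  (v , per , rule) → contradiction
    (trans (sym (per 0)) (trans (rule 0) (cong (nand (v 0)) (trans (per 1) (per 0)))))
    (nand-irreflexive (v 0))
cyclicWords-cardinality (suc (suc k)) =
  cardinality-resp-↔ (cyclicWords↔closed k)
    (subst (HasCardinality _) (count-closed k)
      (subtype-cardinality (λ w → T? (closed w)) (words (2 + k)) words-complete (words-unique (2 + k))))

-- Splitting a trajectory into cyclic words

-- The hypothesis is s ≡ t modulo n, with explicit multiples on both sides in place of a
-- subtraction.
periodic-≡ : ∀ {n} {v : ℕ → Bool} → (∀ t → v (n + t) ≡ v t) →
             ∀ j k {s t} → j * n + s ≡ k * n + t → v s ≡ v t
periodic-≡ {v = v} per j k {s} {t} eq = begin
  v s           ≡⟨ periodic-*+ per j s ⟨
  v (j * _ + s) ≡⟨ cong v eq ⟩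
  v (k * _ + t) ≡⟨ periodic-*+ per k t ⟩
  v t           ∎
  where open ≡-Reasoning

*+-mod : ∀ k δ .{{_ : NonZero δ}} t → (k * δ + t) mod δ ≡ t mod δ
*+-mod k δ t = fromℕ<-cong _ _ (trans (cong (_% δ) (+-comm (k * δ) t)) ([m+kn]%n≡m%n t k δ)) _ _

*+-/ : ∀ k δ .{{_ : NonZero δ}} t → (k * δ + t) / δ ≡ k + t / δ
*+-/ k δ t = trans (+-distrib-/-∣ˡ {k * δ} t (divides k refl)) (cong (_+ t / δ) (m*n/n≡m k δ))

-- Here ℓ and r are the circuit sizes divided by δ, and c inverts ℓ modulo n. Since r ≡ -ℓ modulo n,
-- reading a trajectory in steps of ℓ * δ gives a cyclic word for each residue class modulo δ.
module Decomposition
  (n δ ℓ r c j k q : ℕ) .{{_ : NonZero δ}}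
  (c-inverse : j * n + c * ℓ ≡ k * n + 1)
  (ℓ+r≡q*n : ℓ + r ≡ q * n) where

  open ≡-Reasoning

  private
    L = ℓ * δ
    R = r * δ
    M = n * δ

  strand : (ℕ → Bool) → Fin δ → ℕ → Bool
  strand u i s = u (toℕ i + s * L)

  -- Since c ℓ ≡ 1 modulo n, time t is reached modulo `M` from its residue t mod δ after (t / δ) c
  -- steps of `L`.
  weave : (Fin δ → ℕ → Bool) → ℕ → Bool
  weave f t = f (t mod δ) (t / δ * c)

  -- `n` steps of `L` make `ℓ` laps of `M`, and advancing by `R` undoes one step because `L + R` is
  -- `q` laps.
  strand-cyclic : ∀ {u} → IsTrajectory L R M u → ∀ i → IsCyclicWord n (strand u i)
  strand-cyclic {u} (per , rule) i =
    (λ s → periodic-≡ per 0 ℓ (shift (toℕ i) n s ℓ δ)) ,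
    (λ s → trans (rule (toℕ i + (1 + s) * L)) (cong₂ nand
      (periodic-≡ per 0 q (back s))
      (cong u (forth (toℕ i) s L))))
    where
    shift : ∀ i n s ℓ δ → i + (n + s) * (ℓ * δ) ≡ ℓ * (n * δ) + (i + s * (ℓ * δ))
    shift = solve-∀
    forth : ∀ i s L → L + (i + (1 + s) * L) ≡ i + (2 + s) * L
    forth = solve-∀
    regroup : ∀ i s ℓ r δ → r * δ + (i + (1 + s) * (ℓ * δ)) ≡ (ℓ + r) * δ + (i + s * (ℓ * δ))
    regroup = solve-∀
    back : ∀ s → R + (toℕ i + (1 + s) * L) ≡ q * M + (toℕ i + s * L)
    back s = trans (regroup (toℕ i) s ℓ r δ)
      (cong (_+ (toℕ i + s * L)) (trans (cong (_* δ) ℓ+r≡q*n) (*-assoc q n δ)))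

  weave-*+ : ∀ f k t → weave f (k * δ + t) ≡ f (t mod δ) ((k + t / δ) * c)
  weave-*+ f k t = cong₂ (λ i x → f i (x * c)) (*+-mod k δ t) (*+-/ k δ t)

  -- Advancing time by `L` or `R` keeps the strand and shifts the index within it by c ℓ ≡ 1 or c r
  -- ≡ -1 modulo n, that is, to one of the two neighbours.
  weave-trajectory : ∀ {f} → (∀ i → IsCyclicWord n (f i)) → IsTrajectory L R M (weave f)
  weave-trajectory {f} cyc =
    (λ t → trans (weave-*+ f n t)
      (periodic-≡ (proj₁ (cyc (t mod δ))) 0 c (expand n (t / δ) c))) ,
    -- `y` is the strand index of R + t. Modulo n, the index of t is 1 + y and that of L + t is 2 +
    -- y.
    λ t → let y = (r + t / δ) * c ; v = f (t mod δ) ; per , rule = cyc (t mod δ) in begin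
      v (t / δ * c)
        ≡⟨ periodic-≡ per k (c * q + j) (1+y t) ⟨
      v (1 + y)
        ≡⟨ rule y ⟩
      nand (v y) (v (2 + y))
        ≡⟨ cong (nand (v y)) (periodic-≡ per (k + k) (c * q + j + j) (2+y t)) ⟩
      nand (v y) (v ((ℓ + t / δ) * c))
        ≡⟨ cong₂ nand (weave-*+ f r t) (weave-*+ f ℓ t) ⟨
      nand (weave f (R + t)) (weave f (L + t)) ∎
    where
    expand : ∀ n x c → (n + x) * c ≡ c * n + x * c
    expand = solve-∀
    rearrange₁ : ∀ k n r x c → k * n + (1 + (r + x) * c) ≡ (k * n + 1) + (r * c + x * c)
    rearrange₁ = solve-∀
    rearrange₂ : ∀ j n c ℓ r x → (j * n + c * ℓ) + (r * c + x * c) ≡ c * (ℓ + r) + j * n + x * c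
    rearrange₂ = solve-∀
    rearrange₃ : ∀ c q n j x → c * (q * n) + j * n + x * c ≡ (c * q + j) * n + x * c
    rearrange₃ = solve-∀
    1+y : ∀ t → k * n + (1 + (r + t / δ) * c) ≡ (c * q + j) * n + t / δ * c
    1+y t = begin
      k * n + (1 + (r + x) * c)           ≡⟨ rearrange₁ k n r x c ⟩
      (k * n + 1) + (r * c + x * c)       ≡⟨ cong (_+ (r * c + x * c)) c-inverse ⟨
      (j * n + c * ℓ) + (r * c + x * c)   ≡⟨ rearrange₂ j n c ℓ r x ⟩
      c * (ℓ + r) + j * n + x * c         ≡⟨ cong (λ s → c * s + j * n + x * c) ℓ+r≡q*n ⟩
      c * (q * n) + j * n + x * c         ≡⟨ rearrange₃ c q n j x ⟩
      (c * q + j) * n + x * c             ∎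
      where x = t / δ
    rearrange₄ : ∀ k n y → (k + k) * n + (2 + y) ≡ (k * n + 1) + (k * n + (1 + y))
    rearrange₄ = solve-∀
    rearrange₅ : ∀ j n c ℓ g x → (j * n + c * ℓ) + (g * n + x * c) ≡ (g + j) * n + (ℓ + x) * c
    rearrange₅ = solve-∀
    2+y : ∀ t → (k + k) * n + (2 + (r + t / δ) * c) ≡ (c * q + j + j) * n + (ℓ + t / δ) * c
    2+y t = begin
      (k + k) * n + (2 + (r + t / δ) * c)                    ≡⟨ rearrange₄ k n ((r + t / δ) * c) ⟩
      (k * n + 1) + (k * n + (1 + (r + t / δ) * c))          ≡⟨ cong₂ _+_ (sym c-inverse) (1+y t) ⟩
      (j * n + c * ℓ) + ((c * q + j) * n + t / δ * c)        ≡⟨ rearrange₅ j n c ℓ (c * q + j) (t / δ) ⟩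
      (c * q + j + j) * n + (ℓ + t / δ) * c                  ∎

  strand-weave : ∀ {f} → (∀ i → IsCyclicWord n (f i)) → ∀ i s → strand (weave f) i s ≡ f i s
  strand-weave {f} cyc i s = begin
    weave f (toℕ i + s * L)
      ≡⟨ cong (weave f) (regroup (toℕ i) s ℓ δ) ⟩
    weave f (s * ℓ * δ + toℕ i)
      ≡⟨ weave-*+ f (s * ℓ) (toℕ i) ⟩
    f (toℕ i mod δ) ((s * ℓ + toℕ i / δ) * c)
      ≡⟨ cong₂ (λ i′ x → f i′ ((s * ℓ + x) * c)) (toℕ-mod i) (m<n⇒m/n≡0 (toℕ<n i)) ⟩
    f i ((s * ℓ + 0) * c)
      ≡⟨ periodic-≡ (proj₁ (cyc i)) (s * j) (s * k) scale ⟩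
    f i s ∎
    where
    regroup : ∀ i s ℓ δ → i + s * (ℓ * δ) ≡ s * ℓ * δ + i
    regroup = solve-∀
    factor : ∀ s j n ℓ c → s * j * n + (s * ℓ + 0) * c ≡ s * (j * n + c * ℓ)
    factor = solve-∀
    unfactor : ∀ s k n → s * (k * n + 1) ≡ s * k * n + s
    unfactor = solve-∀
    scale : s * j * n + (s * ℓ + 0) * c ≡ s * k * n + s
    scale = trans (factor s j n ℓ c) (trans (cong (s *_) c-inverse) (unfactor s k n))

  weave-strand : ∀ {u} → IsTrajectory L R M u → ∀ t → weave (strand u) t ≡ u t
  weave-strand {u} (per , _) t =
    periodic-≡ per (t / δ * j) (t / δ * k) (begin
      x * j * M + (toℕ (t mod δ) + x * c * L)
        ≡⟨ cong (λ i → x * j * M + (i + x * c * L)) (toℕ-fromℕ< (m%n<n t δ)) ⟩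
      x * j * M + (t % δ + x * c * L)
        ≡⟨ factor x j n δ (t % δ) c ℓ ⟩
      t % δ + x * (j * n + c * ℓ) * δ
        ≡⟨ cong (λ e → t % δ + x * e * δ) c-inverse ⟩
      t % δ + x * (k * n + 1) * δ
        ≡⟨ unfactor (t % δ) x k n δ ⟩
      x * k * M + (t % δ + x * δ)
        ≡⟨ cong (λ y → x * k * M + y) (m≡m%n+[m/n]*n t δ) ⟨
      x * k * M + t ∎)
    where
    x = t / δ
    factor : ∀ x j n δ i c ℓ → x * j * (n * δ) + (i + x * c * (ℓ * δ)) ≡ i + x * (j * n + c * ℓ) * δ
    factor = solve-∀
    unfactor : ∀ i x k n δ → i + x * (k * n + 1) * δ ≡ x * k * (n * δ) + (i + x * δ)
    unfactor = solve-∀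

  trajectories↔strands : Inverse (Trajectories L R M) (Power (CyclicWords n) δ)
  trajectories↔strands = record
    { to        = λ (u , tr) i → strand u i , strand-cyclic tr i
    ; from      = λ f → weave (λ i → proj₁ (f i)) , weave-trajectory (λ i → proj₂ (f i))
    ; to-cong   = λ u≗v i s → u≗v _
    ; from-cong = λ f≗g t → f≗g (t mod δ) _
    ; inverse   =
        (λ {f} u≗ i s → trans (u≗ _) (strand-weave (λ i → proj₂ (f i)) i s)) ,
        (λ {(u , tr)} f≗ t → trans (f≗ (t mod δ) _) (weave-strand tr t))
    }

-- Arithmetic behind the splitting

bézout : ∀ m n .{{_ : NonZero n}} → ∃ λ c → ∃₂ λ j k → j * n + c * m ≡ k * n + gcd m n
bézout m n@(suc n-1) with Bézout.identity (gcd-GCD m n)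
... | Bézout.+- x y eq = x , 0 , y , trans (sym eq) (+-comm (gcd m n) (y * n))
-- Here m has coefficient - x, which is congruent to `x * n-1` modulo n.
... | Bézout.-+ x y eq = x * n-1 , y , x * m , (begin
  y * n + x * n-1 * m               ≡⟨ cong (_+ x * n-1 * m) eq ⟨
  gcd m n + x * m + x * n-1 * m     ≡⟨ regroup (gcd m n) x m n-1 ⟩
  x * m * n + gcd m n               ∎)
  where
  open ≡-Reasoning
  regroup : ∀ g x m k → g + x * m + x * k * m ≡ x * m * suc k + g
  regroup = solve-∀

-- A common divisor of ℓ and m divides ℓ + r through m, hence divides r as well.
Δ≡gcd : ∀ ℓ r m → m ∣ ℓ + r → Δ ℓ r m ≡ gcd ℓ m
Δ≡gcd ℓ r m m∣ℓ+r = ∣-antisym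
  (gcd-greatest (∣-trans (gcd[m,n]∣m (gcd ℓ r) m) (gcd[m,n]∣m ℓ r)) (gcd[m,n]∣n (gcd ℓ r) m))
  (gcd-greatest
    (gcd-greatest (gcd[m,n]∣m ℓ m)
      (∣m+n∣m⇒∣n (∣-trans (gcd[m,n]∣n ℓ m) m∣ℓ+r) (gcd[m,n]∣m ℓ m)))
    (gcd[m,n]∣n ℓ m))

trajectories-cardinality : ∀ ℓ r m .{{_ : NonZero m}} → m ∣ ℓ + r →
                           HasCardinality (Trajectories ℓ r m) (CΔ ℓ r m)
trajectories-cardinality ℓ r m m∣ℓ+r =
  subst (λ (ℓ′ , r′ , m′) → HasCardinality (Trajectories ℓ′ r′ m′) (CΔ ℓ r m))
    (cong₂ _,_ (m/n*n≡m δ∣ℓ) (cong₂ _,_ (m/n*n≡m δ∣r) (m/n*n≡m δ∣m)))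
    (cardinality-resp-↔ strands (cardinality-power δ (cyclicWords-cardinality n)))
  where
  δ = Δ ℓ r m
  instance
    δ≢0 : NonZero δ
    δ≢0 = Δ-nonZero ℓ r m
  δ∣ℓ : δ ∣ ℓ
  δ∣ℓ = ∣-trans (gcd[m,n]∣m (gcd ℓ r) m) (gcd[m,n]∣m ℓ r)
  δ∣r : δ ∣ r
  δ∣r = ∣-trans (gcd[m,n]∣m (gcd ℓ r) m) (gcd[m,n]∣n ℓ r)
  δ∣m : δ ∣ m
  δ∣m = gcd[m,n]∣n (gcd ℓ r) m
  n = m / δ
  instance
    n≢0 : NonZero n
    n≢0 = m*n≢0⇒m≢0 n {{subst NonZero (sym (m/n*n≡m δ∣m)) (≢-nonZero (≢-nonZero⁻¹ m))}}
  open ≡-Reasoning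
  c j k : ℕ
  c = proj₁ (bézout ℓ m)
  j = proj₁ (proj₂ (bézout ℓ m))
  k = proj₁ (proj₂ (proj₂ (bézout ℓ m)))

  -- The Bézout identity of ℓ and m divided by δ, which is their gcd.
  c-inverse : j * n + c * (ℓ / δ) ≡ k * n + 1
  c-inverse = *-cancelʳ-≡ _ _ δ (begin
    (j * n + c * (ℓ / δ)) * δ       ≡⟨ expand j n c (ℓ / δ) δ ⟩
    j * (n * δ) + c * (ℓ / δ * δ)   ≡⟨ cong₂ (λ x y → j * x + c * y) (m/n*n≡m δ∣m) (m/n*n≡m δ∣ℓ) ⟩
    j * m + c * ℓ                   ≡⟨ proj₂ (proj₂ (proj₂ (bézout ℓ m))) ⟩
    k * m + gcd ℓ m                 ≡⟨ cong₂ (λ x y → k * x + y) (m/n*n≡m δ∣m) (Δ≡gcd ℓ r m m∣ℓ+r) ⟨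
    k * (n * δ) + δ                 ≡⟨ factor k n δ ⟩
    (k * n + 1) * δ                 ∎)
    where
    expand : ∀ j n c x δ → (j * n + c * x) * δ ≡ j * (n * δ) + c * (x * δ)
    expand = solve-∀
    factor : ∀ k n δ → k * (n * δ) + δ ≡ (k * n + 1) * δ
    factor = solve-∀

  q = quotient m∣ℓ+r

  ℓ+r≡q*n : ℓ / δ + r / δ ≡ q * n
  ℓ+r≡q*n = *-cancelʳ-≡ _ _ δ (begin
    (ℓ / δ + r / δ) * δ         ≡⟨ *-distribʳ-+ δ (ℓ / δ) (r / δ) ⟩
    ℓ / δ * δ + r / δ * δ       ≡⟨ cong₂ _+_ (m/n*n≡m δ∣ℓ) (m/n*n≡m δ∣r) ⟩
    ℓ + r                       ≡⟨ m∣n⇒n≡quotient*m m∣ℓ+r ⟩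
    q * m                       ≡⟨ cong (q *_) (m/n*n≡m δ∣m) ⟨
    q * (n * δ)                 ≡⟨ *-assoc q n δ ⟨
    q * n * δ                   ∎)

  strands : Inverse (Trajectories (ℓ / δ * δ) (r / δ * δ) (n * δ)) (Power (CyclicWords n) δ)
  strands = Decomposition.trajectories↔strands n δ (ℓ / δ) (r / δ) c j k q c-inverse ℓ+r≡q*n

periodicConfigs-cardinality : ∀ ℓ r m .{{_ : NonZero ℓ}} .{{_ : NonZero r}} .{{_ : NonZero m}} →
                              m ∣ ℓ + r → HasCardinality (PeriodicConfigs ℓ r m) (CΔ ℓ r m)
periodicConfigs-cardinality ℓ@(suc a) r@(suc b) m m∣ℓ+r =
  cardinality-resp-↔ (Circuit.periodicConfigs↔trajectories a b m∣ℓ+r) (trajectories-cardinality ℓ r m m∣ℓ+r)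

-- Divisor sums

unique⇒↭ : {A : Set} {xs ys : List A} → Unique xs → Unique ys →
           (∀ {x} → x ∈ xs → x ∈ ys) → (∀ {x} → x ∈ ys → x ∈ xs) → xs ↭ ys
unique⇒↭ xs! ys! ⊆ ⊇ = ∼bag⇒↭ (unique∧set⇒bag xs! ys! (mk⇔ ⊆ ⊇))

∑ : {A : Set} → List A → (A → ℤ) → ℤ
∑ xs f = foldr ℤ._+_ 0ℤ (map f xs)

module _ {A : Set} where

  ∑-↭ : {xs ys : List A} (f : A → ℤ) → xs ↭ ys → ∑ xs f ≡ ∑ ys f
  ∑-↭ f ↭.refl = refl
  ∑-↭ f (↭.prep x p) = cong (λ s → f x ℤ.+ s) (∑-↭ f p)
  ∑-↭ f (↭.swap x y p) = trans (x∙yz≈y∙xz ℤ.+-commutativeSemigroup (f x) (f y) _)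
    (cong (λ s → f y ℤ.+ (f x ℤ.+ s)) (∑-↭ f p))
  ∑-↭ f (↭.trans p q) = trans (∑-↭ f p) (∑-↭ f q)

  ∑-cong : ∀ (xs : List A) {f g : A → ℤ} → (∀ {x} → x ∈ xs → f x ≡ g x) → ∑ xs f ≡ ∑ xs g
  ∑-cong []       f≗g = refl
  ∑-cong (x ∷ xs) f≗g = cong₂ ℤ._+_ (f≗g (here refl)) (∑-cong xs (λ x∈ → f≗g (there x∈)))

  ∑-map : {B : Set} (φ : B → A) (xs : List B) (f : A → ℤ) → ∑ (map φ xs) f ≡ ∑ xs (λ x → f (φ x))
  ∑-map φ xs f = cong (foldr ℤ._+_ 0ℤ) (sym (map-∘ xs))

  ∑-++ : ∀ xs ys (f : A → ℤ) → ∑ (xs ++ ys) f ≡ ∑ xs f ℤ.+ ∑ ys f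
  ∑-++ []       ys f = sym (ℤ.+-identityˡ _)
  ∑-++ (x ∷ xs) ys f = trans (cong (λ s → f x ℤ.+ s) (∑-++ xs ys f)) (sym (ℤ.+-assoc (f x) _ _))

  ∑-+ : ∀ xs (f g : A → ℤ) → ∑ xs (λ x → f x ℤ.+ g x) ≡ ∑ xs f ℤ.+ ∑ xs g
  ∑-+ []       f g = refl
  ∑-+ (x ∷ xs) f g = begin
    (f x ℤ.+ g x) ℤ.+ ∑ xs (λ y → f y ℤ.+ g y)  ≡⟨ cong (λ s → (f x ℤ.+ g x) ℤ.+ s) (∑-+ xs f g) ⟩
    (f x ℤ.+ g x) ℤ.+ (∑ xs f ℤ.+ ∑ xs g)       ≡⟨ interchange ℤ.+-commutativeSemigroup (f x) (g x) _ _ ⟩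
    (f x ℤ.+ ∑ xs f) ℤ.+ (g x ℤ.+ ∑ xs g)       ∎
    where
    open ≡-Reasoning

  ∑-0 : ∀ (xs : List A) → ∑ xs (λ _ → 0ℤ) ≡ 0ℤ
  ∑-0 []       = refl
  ∑-0 (x ∷ xs) = trans (ℤ.+-identityˡ _) (∑-0 xs)

  ∑-const : ∀ (xs : List A) c → ∑ xs (λ _ → + c) ≡ + (length xs * c)
  ∑-const []       c = refl
  ∑-const (x ∷ xs) c = cong (λ s → + c ℤ.+ s) (∑-const xs c)

  ∑-length : ∀ (xs : List A) → ∑ xs (λ _ → 1ℤ) ≡ + length xs
  ∑-length xs = trans (∑-const xs 1) (cong +_ (*-identityʳ (length xs)))

  ∑-concatMap : {B : Set} (φ : B → List A) (xs : List B) (f : A → ℤ) →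
                ∑ (concatMap φ xs) f ≡ ∑ xs (λ x → ∑ (φ x) f)
  ∑-concatMap φ []       f = refl
  ∑-concatMap φ (x ∷ xs) f =
    trans (∑-++ (φ x) (concatMap φ xs) f) (cong (λ s → ∑ (φ x) f ℤ.+ s) (∑-concatMap φ xs f))

  ∑-filter : {P : A → Set} (P? : Decidable P) (xs : List A) (f : A → ℤ) →
             ∑ (filter P? xs) f ≡ ∑ xs (λ x → if does (P? x) then f x else 0ℤ)
  ∑-filter P? []       f = refl
  ∑-filter P? (x ∷ xs) f with does (P? x)
  ... | true  = cong (λ s → f x ℤ.+ s) (∑-filter P? xs f)
  ... | false = trans (∑-filter P? xs f) (sym (ℤ.+-identityˡ _))

-- Double counting of the pairs related by `R`, each weighted by `w` at its first entry.
∑-count : {A B : Set} {R : A → B → Set} (R? : ∀ a b → Dec (R a b)) (w : A → ℤ) (as : List A) (bs : List B) →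
  ∑ as (λ a → w a ℤ.* + length (filter (R? a) bs)) ≡
  ∑ bs (λ b → ∑ (filter (λ a → R? a b) as) w)
∑-count R? w as []       = trans (∑-cong as (λ {a} _ → ℤ.*-zeroʳ (w a))) (∑-0 as)
∑-count R? w as (b ∷ bs) = begin
  ∑ as (λ a → w a ℤ.* + length (filter (R? a) (b ∷ bs)))
    ≡⟨ ∑-cong as (λ {a} _ → split a) ⟩
  ∑ as (λ a → (if does (R? a b) then w a else 0ℤ) ℤ.+ w a ℤ.* + length (filter (R? a) bs))
    ≡⟨ ∑-+ as _ _ ⟩
  ∑ as (λ a → if does (R? a b) then w a else 0ℤ) ℤ.+ ∑ as (λ a → w a ℤ.* + length (filter (R? a) bs))
    ≡⟨ cong₂ ℤ._+_ (sym (∑-filter (λ a → R? a b) as w)) (∑-count R? w as bs) ⟩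
  ∑ (filter (λ a → R? a b) as) w ℤ.+ ∑ bs (λ b → ∑ (filter (λ a → R? a b) as) w) ∎
  where
  open ≡-Reasoning
  split : ∀ a → w a ℤ.* + length (filter (R? a) (b ∷ bs)) ≡
                (if does (R? a b) then w a else 0ℤ) ℤ.+ w a ℤ.* + length (filter (R? a) bs)
  split a with does (R? a b)
  ... | true  = ℤ.*-suc (w a) (+ length (filter (R? a) bs))
  ... | false = sym (ℤ.+-identityˡ _)

-- Total division, with n ÷ 0 = 0.
infixl 7 _÷_
_÷_ : ℕ → ℕ → ℕ
n ÷ zero  = 0
n ÷ suc d = n / suc d

/≡÷ : ∀ n d .{{_ : NonZero d}} → n / d ≡ n ÷ d
/≡÷ n (suc d) = refl

m*n÷m≡n : ∀ m n .{{_ : NonZero m}} → m * n ÷ m ≡ n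
m*n÷m≡n m@(suc _) n = trans (cong (_/ m) (*-comm m n)) (m*n/n≡m n m)

m*[n÷m]≡n : ∀ {m n} .{{_ : NonZero m}} → m ∣ n → m * (n ÷ m) ≡ n
m*[n÷m]≡n {m@(suc _)} {n} m∣n = trans (*-comm m (n ÷ m)) (m/n*n≡m m∣n)

range : ℕ → List ℕ
range n = map suc (upTo n)

divisors : ℕ → List ℕ
divisors n = map suc (filter (λ i → suc i ∣? n) (upTo n))

range-unique : ∀ n → Unique (range n)
range-unique n = Unique.map⁺ suc-injective (Unique.upTo⁺ n)

divisors-unique : ∀ n → Unique (divisors n)
divisors-unique n = Unique.map⁺ suc-injective (Unique.filter⁺ _ (Unique.upTo⁺ n))

∈-range⁺ : ∀ {n k} .{{_ : NonZero k}} → k ≤ n → k ∈ range n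
∈-range⁺ {k = suc k} k≤n = ∈-map⁺ suc (∈-upTo⁺ k≤n)

∈-range⁻ : ∀ {n k} → k ∈ range n → NonZero k × k ≤ n
∈-range⁻ k∈ with ∈-map⁻ suc k∈
... | i , i∈ , refl = _ , ∈-upTo⁻ i∈

∈-divisors⁺ : ∀ {n d} .{{_ : NonZero n}} → d ∣ n → d ∈ divisors n
∈-divisors⁺ {n} {zero}  d∣n = contradiction (0∣⇒≡0 d∣n) (≢-nonZero⁻¹ n)
∈-divisors⁺ {n} {suc i} d∣n = ∈-map⁺ suc (∈-filter⁺ (λ i → suc i ∣? n) (∈-upTo⁺ (∣⇒≤ d∣n)) d∣n)

∈-divisors⁻ : ∀ {n d} → d ∈ divisors n → NonZero d × d ∣ n
∈-divisors⁻ {n} d∈ with ∈-map⁻ suc d∈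
... | i , i∈ , refl = _ , proj₂ (∈-filter⁻ (λ i → suc i ∣? n) {xs = upTo n} i∈)

sumOverDivisors≡∑ : ∀ n (f : (d : ℕ) .{{_ : NonZero d}} → ℤ) (g : ℕ → ℤ) →
  (∀ d .{{_ : NonZero d}} → d ∣ n → f d ≡ g d) → sumOverDivisors n f ≡ ∑ (divisors n) g
sumOverDivisors≡∑ n f g f≡g = trans
  (∑-cong is (λ {i} i∈ → f≡g (suc i) (proj₂ (∈-filter⁻ (λ i → suc i ∣? n) {xs = upTo n} i∈))))
  (sym (∑-map suc is g))
  where is = filter (λ i → suc i ∣? n) (upTo n)

divisors-multiples : ∀ d m .{{_ : NonZero d}} .{{_ : NonZero m}} →
  filter (d ∣?_) (divisors (d * m)) ↭ map (d *_) (divisors m)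
divisors-multiples d m = unique⇒↭
  (Unique.filter⁺ (d ∣?_) (divisors-unique (d * m)))
  (Unique.map⁺ (*-cancelˡ-≡ _ _ d) (divisors-unique m))
  (λ q∈ → let q∈div , d∣q = ∈-filter⁻ (d ∣?_) {xs = divisors (d * m)} q∈ in
    to (proj₂ (∈-divisors⁻ q∈div)) d∣q)
  from
  where
  instance _ = m*n≢0 d m
  to : ∀ {q} → q ∣ d * m → d ∣ q → q ∈ map (d *_) (divisors m)
  to q∣dm (divides e refl) rewrite *-comm e d = ∈-map⁺ (d *_) (∈-divisors⁺ (*-cancelˡ-∣ d q∣dm))
  from : ∀ {q} → q ∈ map (d *_) (divisors m) → q ∈ filter (d ∣?_) (divisors (d * m))
  from q∈ with ∈-map⁻ (d *_) q∈
  ... | e , e∈ , refl =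
    ∈-filter⁺ (d ∣?_) (∈-divisors⁺ (*-monoʳ-∣ d (proj₂ (∈-divisors⁻ e∈)))) (m∣m*n e)

-- The inner sum of a Dirichlet convolution g * (1 * f).
∑-multiples : ∀ (g : ℕ → ℤ) {d n} .{{_ : NonZero d}} .{{_ : NonZero n}} → d ∣ n →
  ∑ (filter (d ∣?_) (divisors n)) (λ q → g (n ÷ q)) ≡ ∑ (divisors (n ÷ d)) (λ e → g (n ÷ d ÷ e))
∑-multiples g {d} {n} d∣n@(divides m refl) = begin
  ∑ (filter (d ∣?_) (divisors n)) (λ q → g (n ÷ q))
    ≡⟨ cong (λ n → ∑ (filter (d ∣?_) (divisors n)) (λ q → g (n ÷ q))) (*-comm m d) ⟩
  ∑ (filter (d ∣?_) (divisors (d * m))) (λ q → g (d * m ÷ q))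
    ≡⟨ ∑-↭ _ (divisors-multiples d m) ⟩
  ∑ (map (d *_) (divisors m)) (λ q → g (d * m ÷ q))
    ≡⟨ ∑-map (d *_) (divisors m) _ ⟩
  ∑ (divisors m) (λ e → g (d * m ÷ (d * e)))
    ≡⟨ ∑-cong (divisors m) (λ e∈ → cong g (cancel (∈-divisors⁻ e∈))) ⟩
  ∑ (divisors m) (λ e → g (m ÷ e))
    ≡⟨ cong (λ k → ∑ (divisors k) (λ e → g (k ÷ e))) (trans (cong (_÷ d) (*-comm m d)) (m*n÷m≡n d m)) ⟨
  ∑ (divisors (n ÷ d)) (λ e → g (n ÷ d ÷ e)) ∎
  where
  open ≡-Reasoning
  instance _ = m*n≢0⇒m≢0 m {d}
  cancel : ∀ {e} → NonZero e × e ∣ m → d * m ÷ (d * e) ≡ m ÷ e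
  cancel {e} (e≢0 , divides k refl) = begin
    d * (k * e) ÷ (d * e)  ≡⟨ cong (_÷ (d * e)) (trans (cong (d *_) (*-comm k e)) (sym (*-assoc d e k))) ⟩
    d * e * k ÷ (d * e)    ≡⟨ m*n÷m≡n (d * e) k ⟩
    k                      ≡⟨ m*n÷m≡n e k ⟨
    e * k ÷ e              ≡⟨ cong (_÷ e) (*-comm e k) ⟩
    k * e ÷ e              ∎
    where
    instance
      _ = e≢0
      _ = m*n≢0 d e

divisors-complement : ∀ n .{{_ : NonZero n}} → map (n ÷_) (divisors n) ↭ divisors n
divisors-complement n = unique⇒↭
  (map-unique (divisors-unique n) (λ e∈ → e∈))
  (divisors-unique n)
  to
  from
  where
  ∈-complement : ∀ {d} → NonZero d → d ∣ n → n ÷ d ∈ divisors n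
  ∈-complement {d} d≢0 d∣n = ∈-divisors⁺ (divides d (sym (m*[n÷m]≡n {{d≢0}} d∣n)))
  involutive : ∀ {d} → NonZero d → d ∣ n → n ÷ (n ÷ d) ≡ d
  involutive {d} d≢0 d∣n = begin
    n ÷ (n ÷ d)               ≡⟨ cong (_÷ (n ÷ d)) (trans (*-comm (n ÷ d) d) (m*[n÷m]≡n d∣n)) ⟨
    (n ÷ d) * d ÷ (n ÷ d)     ≡⟨ m*n÷m≡n (n ÷ d) d ⟩
    d                         ∎
    where
    open ≡-Reasoning
    instance
      _ = d≢0
      _ = proj₁ (∈-divisors⁻ {n} (∈-complement d≢0 d∣n))
  to : ∀ {d} → d ∈ map (n ÷_) (divisors n) → d ∈ divisors n
  to d∈ with ∈-map⁻ (n ÷_) d∈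
  ... | e , e∈ , refl = let e≢0 , e∣n = ∈-divisors⁻ e∈ in ∈-complement e≢0 e∣n
  from : ∀ {d} → d ∈ divisors n → d ∈ map (n ÷_) (divisors n)
  from d∈ = let d≢0 , d∣n = ∈-divisors⁻ d∈ in
    subst (_∈ map (n ÷_) (divisors n)) (involutive d≢0 d∣n) (∈-map⁺ (n ÷_) (∈-complement d≢0 d∣n))
  -- `n ÷_` is injective on the divisors of n but not on all numbers, so membership among the
  -- divisors is carried along the list.
  map-unique : ∀ {es} → Unique es → (∀ {e} → e ∈ es → e ∈ divisors n) → Unique (map (n ÷_) es)
  map-unique AllPairs.[]            _   = AllPairs.[]
  map-unique {e ∷ es} (e∉ AllPairs.∷ es!) sub =
    All.tabulate fresh AllPairs.∷ map-unique es! (λ x∈ → sub (there x∈))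
    where
    fresh : ∀ {k} → k ∈ map (n ÷_) es → ¬ (n ÷ e ≡ k)
    fresh k∈ eq with ∈-map⁻ (n ÷_) k∈
    ... | e′ , e′∈ , refl = All.lookup e∉ e′∈ (begin
      e                 ≡⟨ (let e≢0 , e∣n = ∈-divisors⁻ (sub (here refl)) in involutive e≢0 e∣n) ⟨
      n ÷ (n ÷ e)       ≡⟨ cong (n ÷_) eq ⟩
      n ÷ (n ÷ e′)      ≡⟨ (let e≢0 , e∣n = ∈-divisors⁻ (sub (there e′∈)) in involutive e≢0 e∣n) ⟩
      e′                ∎)
      where open ≡-Reasoning

-- The divisor sum of the Möbius function

sign : List ℕ → ℤ
sign ps = if does (unique? _≟_ ps) then -1ℤ ℤ.^ length ps else 0ℤ

sign-unique : ∀ {ps} → Unique ps → sign ps ≡ -1ℤ ℤ.^ length ps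
sign-unique {ps} ps! = cong (λ c → if c then -1ℤ ℤ.^ length ps else 0ℤ) (dec-true (unique? _≟_ ps) ps!)

sign-repeated : ∀ {ps} → ¬ Unique ps → sign ps ≡ 0ℤ
sign-repeated {ps} ¬ps! = cong (λ c → if c then -1ℤ ℤ.^ length ps else 0ℤ) (dec-false (unique? _≟_ ps) ¬ps!)

sign-↭ : ∀ {ps qs} → ps ↭ qs → sign ps ≡ sign qs
sign-↭ {ps} {qs} p = cong₂ (λ c k → if c then -1ℤ ℤ.^ k else 0ℤ)
  (does-⇔ (mk⇔ (resp p) (resp (↭-sym p))) (unique? _≟_ ps) (unique? _≟_ qs))
  (↭-length p)
  where
  resp : ∀ {ps qs : List ℕ} → ps ↭ qs → Unique ps → Unique qs
  resp p = Unique-resp-↭ (setoid ℕ) (↭⇒↭ₛ p)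

-- Prefixing a new prime flips the sign of a list without repetitions and leaves any other list at
-- 0.
sign-∷ : ∀ {p ps} → ¬ p ∈ ps → sign ps ℤ.+ sign (p ∷ ps) ≡ 0ℤ
sign-∷ {p} {ps} p∉ = [ unique , repeated ]′ (toSum (unique? _≟_ ps))
  where
  unique : Unique ps → sign ps ℤ.+ sign (p ∷ ps) ≡ 0ℤ
  unique ps! = trans
    (cong₂ ℤ._+_ (sign-unique ps!)
      (trans (sign-unique (All.tabulate (λ { q∈ refl → p∉ q∈ }) AllPairs.∷ ps!)) (ℤ.-1*i≡-i _)))
    (ℤ.+-inverseʳ (-1ℤ ℤ.^ length ps))
  repeated : ¬ Unique ps → sign ps ℤ.+ sign (p ∷ ps) ≡ 0ℤ
  repeated ¬ps! = cong₂ ℤ._+_ (sign-repeated ¬ps!) (sign-repeated {p ∷ ps} λ { (_ AllPairs.∷ ps!) → ¬ps! ps! })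

-- By unique factorisation every list of prime factors computes `μ`, so for p * n a list that starts
-- with p may be used.
μ≡sign : ∀ {n} .{{_ : NonZero n}} (f : PrimeFactorisation n) → μ n ≡ sign (factors f)
μ≡sign {suc n} f = sign-↭ (factorisationUnique (factorise (suc n)) f)

module _ {p : ℕ} (p-prime : Prime p) where

  private instance _ = prime⇒nonZero p-prime

  cons : ∀ {n} → PrimeFactorisation n → PrimeFactorisation (p * n)
  cons f = record
    { factors         = p ∷ factors f
    ; isFactorisation = cong (p *_) (PrimeFactorisation.isFactorisation f)
    ; factorsPrime    = p-prime ∷ PrimeFactorisation.factorsPrime f
    }

  -- In a sum of μ over the divisors of p * m the terms at n and at p * n cancel, unless p ∣ n, when
  -- the term at p * n vanishes and n itself is of the form p * n′.
  μ-cancel : ∀ n .{{_ : NonZero n}} → (if does (¬? (p ∣? n)) then μ n else 0ℤ) ℤ.+ μ (p * n) ≡ 0ℤ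
  μ-cancel n with p ∣? n
  ... | no  p∤n = trans
    (cong₂ ℤ._+_ (μ≡sign f) (μ≡sign {{m*n≢0 p n}} (cons f)))
    (sign-∷ {ps = factors f} λ p∈ →
      p∤n (subst (p ∣_) (sym (PrimeFactorisation.isFactorisation f)) (∈⇒∣product p∈)))
    where
    f = factorise n
  ... | yes p∣n = trans (ℤ.+-identityˡ _)
    (trans (μ≡sign {{m*n≢0 p n}} (cons f))
      (sign-repeated {p ∷ factors f} λ { (p∉ AllPairs.∷ _) → All.lookup p∉ p∈ refl }))
    where
    f = factorise n
    p∈ : p ∈ factors f
    p∈ = factorisationHasAllPrimeFactors p-prime
      (subst (p ∣_) (PrimeFactorisation.isFactorisation f) p∣n) (PrimeFactorisation.factorsPrime f)

  -- A divisor of p * m that p does not divide is coprime to p and so divides m. The filter keeps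
  -- the two parts disjoint.
  divisors-prime* : ∀ m .{{_ : NonZero m}} →
    divisors (p * m) ↭ filter (λ d → ¬? (p ∣? d)) (divisors m) ++ map (p *_) (divisors m)
  divisors-prime* m = unique⇒↭
    (divisors-unique (p * m))
    (Unique.++⁺ (Unique.filter⁺ p∤? (divisors-unique m))
      (Unique.map⁺ (*-cancelˡ-≡ _ _ p) (divisors-unique m)) disjoint)
    (λ d∈ → to (proj₂ (∈-divisors⁻ d∈)))
    (λ d∈ → [ fromˡ , fromʳ ]′ (∈-++⁻ (filter p∤? (divisors m)) d∈))
    where
    instance _ = m*n≢0 p m
    p∤? = λ d → ¬? (p ∣? d)
    disjoint : ∀ {d} → ¬ (d ∈ filter p∤? (divisors m) × d ∈ map (p *_) (divisors m))
    disjoint (d∈ , pe∈) with ∈-map⁻ (p *_) pe∈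
    ... | e , _ , refl = proj₂ (∈-filter⁻ p∤? {xs = divisors m} d∈) (m∣m*n e)
    coprime-p : ∀ {d} → ¬ p ∣ d → Coprime d p
    coprime-p p∤d (e∣d , e∣p) with prime⇒irreducible p-prime e∣p
    ... | inj₁ e≡1    = e≡1
    ... | inj₂ refl = contradiction e∣d p∤d
    to : ∀ {d} → d ∣ p * m → d ∈ filter p∤? (divisors m) ++ map (p *_) (divisors m)
    to {d} d∣pm with p ∣? d
    ... | no p∤d = ∈-++⁺ˡ (∈-filter⁺ p∤? (∈-divisors⁺ (coprime-divisor (coprime-p p∤d) d∣pm)) p∤d)
    ... | yes (divides e refl) rewrite *-comm e p =
      ∈-++⁺ʳ _ (∈-map⁺ (p *_) (∈-divisors⁺ (*-cancelˡ-∣ p d∣pm)))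
    fromˡ : ∀ {d} → d ∈ filter p∤? (divisors m) → d ∈ divisors (p * m)
    fromˡ d∈ = ∈-divisors⁺
      (∣n⇒∣m*n p (proj₂ (∈-divisors⁻ (proj₁ (∈-filter⁻ p∤? {xs = divisors m} d∈)))))
    fromʳ : ∀ {d} → d ∈ map (p *_) (divisors m) → d ∈ divisors (p * m)
    fromʳ d∈ with ∈-map⁻ (p *_) d∈
    ... | e , e∈ , refl = ∈-divisors⁺ (*-monoʳ-∣ p (proj₂ (∈-divisors⁻ e∈)))

  ∑μ-prime* : ∀ m .{{_ : NonZero m}} → ∑ (divisors (p * m)) μ ≡ 0ℤ
  ∑μ-prime* m = begin
    ∑ (divisors (p * m)) μ
      ≡⟨ ∑-↭ μ (divisors-prime* m) ⟩
    ∑ (filter p∤? (divisors m) ++ map (p *_) (divisors m)) μ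
      ≡⟨ ∑-++ (filter p∤? (divisors m)) _ μ ⟩
    ∑ (filter p∤? (divisors m)) μ ℤ.+ ∑ (map (p *_) (divisors m)) μ
      ≡⟨ cong₂ ℤ._+_ (∑-filter p∤? (divisors m) μ) (∑-map (p *_) (divisors m) μ) ⟩
    ∑ (divisors m) (λ d → if does (p∤? d) then μ d else 0ℤ) ℤ.+ ∑ (divisors m) (λ d → μ (p * d))
      ≡⟨ ∑-+ (divisors m) _ _ ⟨
    ∑ (divisors m) (λ d → (if does (p∤? d) then μ d else 0ℤ) ℤ.+ μ (p * d))
      ≡⟨ ∑-cong (divisors m) (λ {d} d∈ → μ-cancel d {{proj₁ (∈-divisors⁻ {m} d∈)}}) ⟩
    ∑ (divisors m) (λ _ → 0ℤ)
      ≡⟨ ∑-0 (divisors m) ⟩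
    0ℤ ∎
    where
    open ≡-Reasoning
    p∤? = λ d → ¬? (p ∣? d)

-- The argument n ÷ d is the form in which `convolution` delivers the sum; passing to complementary
-- divisors gives the plain sum of `μ`, which any prime factor of n makes cancel.
∑μ : ∀ n .{{_ : NonZero n}} → ∑ (divisors n) (λ d → μ (n ÷ d)) ≡ (if does (n ≟ 1) then 1ℤ else 0ℤ)
∑μ n = trans
  (trans (sym (∑-map (n ÷_) (divisors n) μ)) (∑-↭ μ (divisors-complement n)))
  (∑μ′ n (factorise n))
  where
  ∑μ′ : ∀ n .{{_ : NonZero n}} → PrimeFactorisation n → ∑ (divisors n) μ ≡ (if does (n ≟ 1) then 1ℤ else 0ℤ)
  ∑μ′ n record { factors = [] ; isFactorisation = refl } = refl
  ∑μ′ n record { factors = p ∷ ps ; isFactorisation = refl ; factorsPrime = p-prime ∷ _ } = trans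
    (∑μ-prime* p-prime (product ps) {{m*n≢0⇒n≢0 p}})
    (sym (cong (λ c → if c then 1ℤ else 0ℤ) (dec-false (n ≟ 1)
      (λ n≡1 → ¬prime[1] (subst Prime (m*n≡1⇒m≡1 p (product ps) n≡1) p-prime)))))

-- The divisor sum of the totient

totatives-↭ : ∀ q m .{{_ : NonZero q}} .{{_ : NonZero m}} →
  map (q *_) (filter (λ k → coprime? k m) (range m)) ↭ filter (λ k → gcd k (q * m) ≟ q) (range (q * m))
totatives-↭ q m = unique⇒↭
  (Unique.map⁺ (*-cancelˡ-≡ _ _ q) (Unique.filter⁺ _ (range-unique m)))
  (Unique.filter⁺ _ (range-unique (q * m)))
  to
  (λ k∈ → let k∈range , gcd≡q = ∈-filter⁻ gcd? {xs = range (q * m)} k∈ ; k≢0 , k≤ = ∈-range⁻ k∈range in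
    from {{k≢0}} k≤ gcd≡q)
  where
  gcd? = λ k → gcd k (q * m) ≟ q
  coprime-m? = λ k → coprime? k m
  to : ∀ {k} → k ∈ map (q *_) (filter coprime-m? (range m)) → k ∈ filter gcd? (range (q * m))
  to k∈ with ∈-map⁻ (q *_) k∈
  ... | e , e∈ , refl with ∈-filter⁻ coprime-m? {xs = range m} e∈
  ...   | e∈range , e⊥m with ∈-range⁻ e∈range
  ...     | e≢0 , e≤m = ∈-filter⁺ gcd? (∈-range⁺ {{m*n≢0 q e {{it}} {{e≢0}}}} (*-monoʳ-≤ q e≤m)) (begin
    gcd (q * e) (q * m) ≡⟨ c*gcd[m,n]≡gcd[cm,cn] q e m ⟨
    q * gcd e m         ≡⟨ cong (q *_) (coprime⇒gcd≡1 e⊥m) ⟩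
    q * 1               ≡⟨ *-identityʳ q ⟩
    q                   ∎)
    where open ≡-Reasoning
  from : ∀ {k} .{{_ : NonZero k}} → k ≤ q * m → gcd k (q * m) ≡ q →
         k ∈ map (q *_) (filter coprime-m? (range m))
  from {k} k≤ gcd≡q with subst (_∣ k) gcd≡q (gcd[m,n]∣m k (q * m))
  ... | divides e refl rewrite *-comm e q =
    ∈-map⁺ (q *_) (∈-filter⁺ coprime-m? (∈-range⁺ {{m*n≢0⇒n≢0 q}} (*-cancelˡ-≤ q k≤))
      (gcd≡1⇒coprime (*-cancelˡ-≡ _ _ q
        (trans (c*gcd[m,n]≡gcd[cm,cn] q e m) (trans gcd≡q (sym (*-identityʳ q)))))))

ψ-÷ : ∀ n q .{{_ : NonZero n}} .{{_ : NonZero q}} → q ∣ n →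
      ψ (n ÷ q) ≡ length (filter (λ k → gcd k n ≟ q) (range n))
ψ-÷ n q (divides m refl) = begin
  ψ (m * q ÷ q)
    ≡⟨ cong ψ (trans (cong (_÷ q) (*-comm m q)) (m*n÷m≡n q m)) ⟩
  ψ m
    ≡⟨ length-map (q *_) (filter (λ k → coprime? k m) (range m)) ⟨
  length (map (q *_) (filter (λ k → coprime? k m) (range m)))
    ≡⟨ ↭-length (totatives-↭ q m {{it}} {{m*n≢0⇒m≢0 m}}) ⟩
  length (filter (λ k → gcd k (q * m) ≟ q) (range (q * m)))
    ≡⟨ cong (λ n → length (filter (λ k → gcd k n ≟ q) (range n))) (*-comm q m) ⟩
  length (filter (λ k → gcd k (m * q) ≟ q) (range (m * q))) ∎
  where open ≡-Reasoning

-- Gauss's argument: the numbers 1, ..., n are sorted by their gcd with n, and the class of gcd q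
-- has ψ (n / q) elements.
∑ψ : ∀ n .{{_ : NonZero n}} → ∑ (divisors n) (λ q → + ψ (n ÷ q)) ≡ + n
∑ψ n = begin
  ∑ (divisors n) (λ q → + ψ (n ÷ q))
    ≡⟨ ∑-cong (divisors n) (λ {q} q∈ → let q≢0 , q∣n = ∈-divisors⁻ q∈ in
         trans (cong +_ (ψ-÷ n q {{it}} {{q≢0}} q∣n)) (sym (ℤ.*-identityˡ _))) ⟩
  ∑ (divisors n) (λ q → 1ℤ ℤ.* + length (filter (λ k → gcd k n ≟ q) (range n)))
    ≡⟨ ∑-count (λ q k → gcd k n ≟ q) (λ _ → 1ℤ) (divisors n) (range n) ⟩
  ∑ (range n) (λ k → ∑ (filter (λ q → gcd k n ≟ q) (divisors n)) (λ _ → 1ℤ))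
    ≡⟨ ∑-cong (range n) (λ {k} _ → ∑-↭ (λ _ → 1ℤ) (singleton k)) ⟩
  ∑ (range n) (λ _ → 1ℤ)
    ≡⟨ ∑-length (range n) ⟩
  + length (range n)
    ≡⟨ cong +_ (trans (length-map suc (upTo n)) (length-upTo n)) ⟩
  + n ∎
  where
  open ≡-Reasoning
  singleton : ∀ k → filter (λ q → gcd k n ≟ q) (divisors n) ↭ gcd k n ∷ []
  singleton k = unique⇒↭
    (Unique.filter⁺ (λ q → gcd k n ≟ q) (divisors-unique n))
    ([] AllPairs.∷ AllPairs.[])
    (λ q∈ → here (sym (proj₂ (∈-filter⁻ (λ q → gcd k n ≟ q) {xs = divisors n} q∈))))
    (λ { (here refl) → ∈-filter⁺ (λ q → gcd k n ≟ q) (∈-divisors⁺ (gcd[m,n]∣n k n)) refl })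

-- Counting attractors

module _ (ℓ r : ℕ) .{{ℓ≢0 : NonZero ℓ}} .{{r≢0 : NonZero r}} where

  private
    X = Config ℓ r
    N = ℓ + r
    f = F ℓ r
    instance
      N≢0 : NonZero N
      N≢0 = +-nonZero ℓ r
    all : List X
    all = words (ℓ + pred r)

  period⇒period-N : ∀ {p x} .{{_ : NonZero p}} → HasPeriod ℓ r p x → HasPeriod ℓ r N x
  period⇒period-N = go ℓ r
    where
    go : ∀ ℓ r .{{_ : NonZero ℓ}} .{{_ : NonZero r}} {p x} .{{_ : NonZero p}} →
         HasPeriod ℓ r p x → HasPeriod ℓ r (ℓ + r) x
    go (suc a) (suc b) {p} = Circuit.periodic⇒period-N a b {p}

  F^-+ : ∀ j k x → F^ ℓ r (j + k) x ≡ F^ ℓ r j (F^ ℓ r k x)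
  F^-+ = ^-+ X f

  F^-comm : ∀ j k x → F^ ℓ r j (F^ ℓ r k x) ≡ F^ ℓ r k (F^ ℓ r j x)
  F^-comm j k x = trans (sym (F^-+ j k x)) (trans (cong (λ i → F^ ℓ r i x) (+-comm j k)) (F^-+ k j x))

  hasPeriod-∣ : ∀ {p q x} → HasPeriod ℓ r p x → p ∣ q → HasPeriod ℓ r q x
  hasPeriod-∣ {p} = periodic-∣ X f {p}

  hasPeriod-F^ : ∀ {p x} k → HasPeriod ℓ r p x → HasPeriod ℓ r p (F^ ℓ r k x)
  hasPeriod-F^ {p} {x} k per = trans (F^-comm p k x) (cong (F^ ℓ r k) per)

  F^-% : ∀ {p x} .{{_ : NonZero p}} k → HasPeriod ℓ r p x → F^ ℓ r k x ≡ F^ ℓ r (k % p) x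
  F^-% {p} {x} k per = begin
    F^ ℓ r k x                            ≡⟨ cong (λ i → F^ ℓ r i x) (m≡m%n+[m/n]*n k p) ⟩
    F^ ℓ r (k % p + k / p * p) x          ≡⟨ F^-+ (k % p) (k / p * p) x ⟩
    F^ ℓ r (k % p) (F^ ℓ r (k / p * p) x) ≡⟨ cong (F^ ℓ r (k % p)) (periodic-multiple X f {p} per (k / p)) ⟩
    F^ ℓ r (k % p) x                      ∎
    where open ≡-Reasoning

  F^-return : ∀ {x} k → HasPeriod ℓ r N x → ∃[ j ] F^ ℓ r j (F^ ℓ r k x) ≡ x
  F^-return {x} k per = k * N ∸ k , (begin
    F^ ℓ r (k * N ∸ k) (F^ ℓ r k x) ≡⟨ F^-+ (k * N ∸ k) k x ⟨
    F^ ℓ r (k * N ∸ k + k) x        ≡⟨ cong (λ i → F^ ℓ r i x) (m∸n+n≡m (m≤m*n k N)) ⟩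
    F^ ℓ r (k * N) x                ≡⟨ periodic-multiple X f {N} per k ⟩
    x                               ∎)
    where open ≡-Reasoning

  _≟ˣ_ : (x y : X) → Dec (x ≡ y)
  _≟ˣ_ = ≡-dec _≟ᵇ_

  hasPeriod? : ∀ p x → Dec (HasPeriod ℓ r p x)
  hasPeriod? p x = F^ ℓ r p x ≟ˣ x

  exactPeriod : ∀ {x} q → 1 ≤ q → HasPeriod ℓ r q x → ∃[ p ] HasExactPeriod ℓ r p x
  exactPeriod {x} = <-rec _ λ q rec 1≤q per →
    descend q rec 1≤q per (anyUpTo? (λ d → 1 ≤? d ×-dec hasPeriod? d x) q)
    where
    descend : ∀ q → (∀ {d} → d < q → 1 ≤ d → HasPeriod ℓ r d x → ∃[ p ] HasExactPeriod ℓ r p x) →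
               1 ≤ q → HasPeriod ℓ r q x →
               Dec (∃ λ d → d < q × 1 ≤ d × HasPeriod ℓ r d x) → ∃[ p ] HasExactPeriod ℓ r p x
    descend q rec 1≤q per (yes (d , d<q , 1≤d , per-d)) = rec d<q 1≤d per-d
    descend q rec 1≤q per (no ¬smaller) =
      q , 1≤q , per , λ d 1≤d d<q per-d → ¬smaller (d , d<q , 1≤d , per-d)

  exact-nonZero : ∀ {p x} → HasExactPeriod ℓ r p x → NonZero p
  exact-nonZero (1≤p , _) = >-nonZero 1≤p

  exact⇒period-N : ∀ {p x} → HasExactPeriod ℓ r p x → HasPeriod ℓ r N x
  exact⇒period-N {p} ex@(_ , per , _) = period⇒period-N {p} {{exact-nonZero ex}} per

  -- Otherwise the remainder of q modulo p would be a period with 1 ≤ d < p.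
  exact-∣ : ∀ {p q x} → HasExactPeriod ℓ r p x → HasPeriod ℓ r q x → p ∣ q
  exact-∣ {p} {q} {x} ex@(_ , per , minimal) per-q with q % p in eq
    where instance _ = exact-nonZero ex
  ... | zero  = m%n≡0⇒n∣m q p {{exact-nonZero ex}} eq
  ... | suc d = contradiction
    (subst (λ d → HasPeriod ℓ r d x) eq (trans (sym (F^-% {p} q per)) per-q))
    (minimal (suc d) (s≤s z≤n) (subst (_< p) eq (m%n<n q p)))
    where instance _ = exact-nonZero ex

  exact-unique : ∀ {p q x} → HasExactPeriod ℓ r p x → HasExactPeriod ℓ r q x → p ≡ q
  exact-unique {p} {q} ex ex′ =
    ∣-antisym (exact-∣ {p} {q} ex (proj₁ (proj₂ ex′))) (exact-∣ {q} {p} ex′ (proj₁ (proj₂ ex)))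

  -- A smaller period of the image would be carried on along the orbit until it returns to `x`.
  exact-F^ : ∀ {p x} k → HasExactPeriod ℓ r p x → HasExactPeriod ℓ r p (F^ ℓ r k x)
  exact-F^ {p} {x} k ex@(1≤p , per , minimal) = 1≤p , hasPeriod-F^ {p} k per , λ d 1≤d d<p per-d →
    let j , back = F^-return k (exact⇒period-N {p} ex) in
    minimal d 1≤d d<p (subst (HasPeriod ℓ r d) back (hasPeriod-F^ {d} j per-d))

  -- The value is arbitrary on configurations outside all attractors.
  period : X → ℕ
  period x with hasPeriod? N x
  ... | yes per = proj₁ (exactPeriod N (>-nonZero⁻¹ N) per)
  ... | no  _   = 1

  period-exact : ∀ {x} → HasPeriod ℓ r N x → HasExactPeriod ℓ r (period x) x
  period-exact {x} per with hasPeriod? N x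
  ... | yes per′ = proj₂ (exactPeriod N (>-nonZero⁻¹ N) per′)
  ... | no  ¬per = contradiction per ¬per

  period-nonZero : ∀ {x} → HasPeriod ℓ r N x → NonZero (period x)
  period-nonZero per = exact-nonZero (period-exact per)

  period-≡ : ∀ {p x} → HasExactPeriod ℓ r p x → period x ≡ p
  period-≡ {p} ex = exact-unique {_} {p} (period-exact (exact⇒period-N {p} ex)) ex

  exact? : ∀ p → Decidable (HasExactPeriod ℓ r p)
  exact? p x = map′
    (λ { (per , refl) → period-exact per })
    (λ ex → exact⇒period-N {p} ex , period-≡ {p} ex)
    (hasPeriod? N x ×-dec period x ≟ p)

  periodic? : Decidable (λ x → ∃[ p ] HasExactPeriod ℓ r p x)
  periodic? x = map′ (λ per → period x , period-exact per) (λ (p , ex) → exact⇒period-N {p} ex) (hasPeriod? N x)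

  -- Instantiated both with a single exact period and with all of them; what is used of `P` is that
  -- it is decidable, forces period N and is invariant under `F`.
  module Attractor
    {P : X → Set} (P? : Decidable P)
    (P⇒period-N : ∀ {x : X} → P x → HasPeriod ℓ r N x)
    (P-F^ : ∀ {x : X} (k : ℕ) → P x → P (F^ ℓ r k x)) where

    private
      S = Orbits ℓ r P
      open Setoid S using (_≈_)

    orbit-F^ : ∀ {x} k (px : P x) (pz : P (F^ ℓ r k x)) → (x , px) ≈ (F^ ℓ r k x , pz)
    orbit-F^ {x} k px pz = let j , back = F^-return k (P⇒period-N px) in
      (λ { (i , refl) → i + j , trans (F^-+ i j (F^ ℓ r k x)) (cong (F^ ℓ r i) back) }) ,
      (λ { (i , refl) → i + k , F^-+ i k x })

    cycle : X → List X
    cycle x = applyUpTo (λ k → F^ ℓ r k x) (period x)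

    ∈-cycle : ∀ {x} k → P x → F^ ℓ r k x ∈ cycle x
    ∈-cycle {x} k px = subst (_∈ cycle x)
      (sym (F^-% {period x} k (proj₁ (proj₂ (period-exact (P⇒period-N px))))))
      (∈-applyUpTo⁺ (λ k → F^ ℓ r k x) (m%n<n k (period x)))
      where instance _ = period-nonZero (P⇒period-N px)

    -- Equality of orbits quantifies over all exponents. Recurrence bounds the search to one cycle
    -- of `x`, and a single common point makes the orbits equal.
    _≟ₛ_ : ∀ x y → Dec (x ≈ y)
    (x , px) ≟ₛ (y , py) = map′ to from (Any.any? (y ≟ˣ_) (cycle x))
      where
      to : y ∈ cycle x → (x , px) ≈ (y , py)
      to y∈ with ∈-applyUpTo⁻ (λ k → F^ ℓ r k x) y∈
      ... | k , _ , refl = orbit-F^ k px py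
      from : (x , px) ≈ (y , py) → y ∈ cycle x
      from (_ , y⊆x) with y⊆x (0 , refl)
      ... | k , refl = ∈-cycle k px

    orbitDecSetoid : DecSetoid 0ℓ 0ℓ
    orbitDecSetoid = record
      { isDecEquivalence = record { isEquivalence = Setoid.isEquivalence S ; _≟_ = _≟ₛ_ } }

    representatives : List (∃ P)
    representatives = deduplicate _≟ₛ_ (subtype P? all)

    representatives-unique : SetoidUnique.Unique S representatives
    representatives-unique = deduplicate-! orbitDecSetoid (subtype P? all)

    representatives-complete : ∀ x → SetoidMembership._∈_ S x representatives
    representatives-complete x = ∈-deduplicate⁺ S _≟ₛ_ (λ {x y z} → respʳ-flip S {x} {y} {z}) {z = x}
      (Any.map (λ {y} → same-orbit {y}) (subtype-complete P? all words-complete x))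
      where
      same-orbit : ∀ {y} → proj₁ x ≡ proj₁ y → x ≈ y
      same-orbit refl = (λ z∈ → z∈) , (λ z∈ → z∈)

    orbits-cardinality : HasCardinality S (length representatives)
    orbits-cardinality = enumeration⇒cardinality representatives-unique representatives-complete

    cycle-unique : ∀ {x} → P x → Unique (cycle x)
    cycle-unique {x} px = Unique.applyUpTo⁺₁ (λ k → F^ ℓ r k x) p λ {i} {j} i<j j<p eq →
      -- If `F^ i x` equals `F^ j x`, then p - j further steps lead back to `x`, so p - j + i would
      -- be a period below p.
      minimal (p ∸ j + i)
        (≤-trans (m<n⇒0<n∸m j<p) (m≤m+n (p ∸ j) i))
        (<-≤-trans (+-monoʳ-< (p ∸ j) i<j) (≤-reflexive (m∸n+n≡m (<⇒≤ j<p))))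
        (begin
          F^ ℓ r (p ∸ j + i) x          ≡⟨ F^-+ (p ∸ j) i x ⟩
          F^ ℓ r (p ∸ j) (F^ ℓ r i x)   ≡⟨ cong (F^ ℓ r (p ∸ j)) eq ⟩
          F^ ℓ r (p ∸ j) (F^ ℓ r j x)   ≡⟨ F^-+ (p ∸ j) j x ⟨
          F^ ℓ r (p ∸ j + j) x          ≡⟨ cong (λ k → F^ ℓ r k x) (m∸n+n≡m (<⇒≤ j<p)) ⟩
          F^ ℓ r p x                    ≡⟨ per ⟩
          x                             ∎)
      where
      open ≡-Reasoning
      p = period x
      ex : HasExactPeriod ℓ r p x
      ex = period-exact (P⇒period-N px)
      per = proj₁ (proj₂ ex)
      minimal = proj₂ (proj₂ ex)

    cycle-disjoint : ∀ {x y} → ¬ (x ≈ y) → Disjoint (cycle (proj₁ x)) (cycle (proj₁ y))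
    cycle-disjoint {x , px} {y , py} x≉y (z∈x , z∈y)
      with ∈-applyUpTo⁻ (λ k → F^ ℓ r k x) z∈x | ∈-applyUpTo⁻ (λ k → F^ ℓ r k y) z∈y
    ... | i , _ , refl | j , _ , eq = x≉y (Setoid.trans S {x , px} {_ , P-F^ i px} {y , py}
      (orbit-F^ i px (P-F^ i px))
      (Setoid.sym S {y , py} {_ , P-F^ i px} (same {pz = P-F^ i px} eq)))
      where
      same : ∀ {z} {pz : P z} → z ≡ F^ ℓ r j y → (y , py) ≈ (z , pz)
      same {pz = pz} refl = orbit-F^ j py pz

    cycles-↭ : filter P? all ↭ concatMap (λ x → cycle (proj₁ x)) representatives
    cycles-↭ = unique⇒↭
      (Unique.filter⁺ P? (words-unique (ℓ + pred r)))
      (Unique.concat⁺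
        (All.map⁺ (All.universal (λ (x , px) → cycle-unique px) representatives))
        (AllPairs.map⁺ (AllPairs.map (λ {x} {y} → cycle-disjoint {x} {y}) representatives-unique)))
      (λ x∈ → to (proj₂ (∈-filter⁻ P? {xs = all} x∈)))
      (λ z∈ → from (Any.satisfied (∈-concatMap⁻ (λ x → cycle (proj₁ x)) {representatives} z∈)))
      where
      to : ∀ {x} → P x → x ∈ concatMap (λ x → cycle (proj₁ x)) representatives
      to {x} px = ∈-concatMap⁺ (λ x → cycle (proj₁ x))
        (Any.map (λ {y} → in-cycle {y}) (representatives-complete (x , px)))
        where
        in-cycle : ∀ {y} → (x , px) ≈ y → x ∈ cycle (proj₁ y)
        in-cycle {y , py} (x⊆y , _) with x⊆y (0 , refl)
        ... | k , refl = ∈-cycle k py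
      from : ∀ {z} → (∃ λ x → z ∈ cycle (proj₁ x)) → z ∈ filter P? all
      from ((x , px) , z∈) with ∈-applyUpTo⁻ (λ k → F^ ℓ r k x) z∈
      ... | k , _ , refl = ∈-filter⁺ P? (words-complete _) (P-F^ k px)

    period-F^ : ∀ {x} k → P x → period (F^ ℓ r k x) ≡ period x
    period-F^ {x} k px = period-≡ {period x} (exact-F^ {period x} k (period-exact (P⇒period-N px)))

    -- Each orbit of size d contributes d · (c / d) = c.
    ∑-orbits : ∀ c → (∀ {x} → P x → period x ∣ c) →
      ∑ (filter P? all) (λ x → + (c ÷ period x)) ≡ + (length representatives * c)
    ∑-orbits c period∣c = begin
      ∑ (filter P? all) w
        ≡⟨ ∑-↭ w cycles-↭ ⟩
      ∑ (concatMap (λ x → cycle (proj₁ x)) representatives) w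
        ≡⟨ ∑-concatMap (λ x → cycle (proj₁ x)) representatives w ⟩
      ∑ representatives (λ x → ∑ (cycle (proj₁ x)) w)
        ≡⟨ ∑-cong representatives (λ {x} _ → ∑-cycle (proj₂ x)) ⟩
      ∑ representatives (λ _ → + c)
        ≡⟨ ∑-const representatives c ⟩
      + (length representatives * c) ∎
      where
      open ≡-Reasoning
      w : X → ℤ
      w x = + (c ÷ period x)
      ∑-cycle : ∀ {x} → P x → ∑ (cycle x) w ≡ + c
      ∑-cycle {x} px = begin
        ∑ (cycle x) w
          ≡⟨ ∑-cong (cycle x) invariant ⟩
        ∑ (cycle x) (λ _ → w x)
          ≡⟨ ∑-const (cycle x) (c ÷ period x) ⟩
        + (length (cycle x) * (c ÷ period x))
          ≡⟨ cong (λ n → + (n * (c ÷ period x))) (length-applyUpTo (λ k → F^ ℓ r k x) (period x)) ⟩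
        + (period x * (c ÷ period x))
          ≡⟨ cong +_ (m*[n÷m]≡n {{period-nonZero (P⇒period-N px)}} (period∣c px)) ⟩
        + c ∎
        where
        invariant : ∀ {z} → z ∈ cycle x → w z ≡ w x
        invariant z∈ with ∈-applyUpTo⁻ (λ k → F^ ℓ r k x) z∈
        ... | k , _ , refl = cong (λ p → + (c ÷ p)) (period-F^ k px)

  -- From periodic configurations to attractors

  periodicCount : ℕ → ℕ
  periodicCount m = length (filter (hasPeriod? m) all)

  -- One setoid counted twice, through cyclic words and by filtering the list of all configurations.
  -- The second count is a sum over configurations and can be interchanged with the divisor sum.
  CΔ≡periodicCount : ∀ m .{{_ : NonZero m}} → m ∣ N → CΔ ℓ r m ≡ periodicCount m
  CΔ≡periodicCount m m∣N = cardinality-unique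
    (periodicConfigs-cardinality ℓ r m m∣N)
    (subtype-cardinality (hasPeriod? m) all words-complete (words-unique (ℓ + pred r)))

  -- The weight `g` is left open to serve both `μ` and `ψ`. For fixed x, the multiples of its exact
  -- period among the divisors of p correspond to the divisors of the quotient.
  convolution : ∀ (g : ℕ → ℤ) p .{{_ : NonZero p}} → p ∣ N →
    ∑ (divisors p) (λ q → g (p ÷ q) ℤ.* + periodicCount q) ≡
    ∑ (filter (hasPeriod? p) all) (λ x → ∑ (divisors (p ÷ period x)) (λ e → g (p ÷ period x ÷ e)))
  convolution g p p∣N = begin
    ∑ (divisors p) (λ q → g (p ÷ q) ℤ.* + periodicCount q)
      ≡⟨ ∑-cong (divisors p) (λ {q} q∈ →
           cong (λ n → g (p ÷ q) ℤ.* + n) (↭-length (by-period q (proj₂ (∈-divisors⁻ q∈))))) ⟩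
    ∑ (divisors p) (λ q → g (p ÷ q) ℤ.* + length (filter (λ x → period x ∣? q) L))
      ≡⟨ ∑-count (λ q x → period x ∣? q) (λ q → g (p ÷ q)) (divisors p) L ⟩
    ∑ L (λ x → ∑ (filter (period x ∣?_) (divisors p)) (λ q → g (p ÷ q)))
      ≡⟨ ∑-cong L (λ {x} x∈ → let per = proj₂ (∈-filter⁻ (hasPeriod? p) {xs = all} x∈) in
           ∑-multiples g {{period-nonZero (to-N per)}} (exact-∣ {period x} {p} (period-exact (to-N per)) per)) ⟩
    ∑ L (λ x → ∑ (divisors (p ÷ period x)) (λ e → g (p ÷ period x ÷ e))) ∎
    where
    open ≡-Reasoning
    L = filter (hasPeriod? p) all
    to-N : ∀ {x} → HasPeriod ℓ r p x → HasPeriod ℓ r N x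
    to-N per = hasPeriod-∣ {p} per p∣N
    by-period : ∀ q → q ∣ p → filter (hasPeriod? q) all ↭ filter (λ x → period x ∣? q) L
    by-period q q∣p = unique⇒↭
      (Unique.filter⁺ (hasPeriod? q) (words-unique (ℓ + pred r)))
      (Unique.filter⁺ _ (Unique.filter⁺ (hasPeriod? p) (words-unique (ℓ + pred r))))
      to from
      where
      to : ∀ {x} → x ∈ filter (hasPeriod? q) all → x ∈ filter (λ x → period x ∣? q) L
      to {x} x∈ = let per = proj₂ (∈-filter⁻ (hasPeriod? q) {xs = all} x∈) ; per-p = hasPeriod-∣ {q} per q∣p in
        ∈-filter⁺ (λ x → period x ∣? q) (∈-filter⁺ (hasPeriod? p) (words-complete x) per-p)
          (exact-∣ {period x} {q} (period-exact (to-N per-p)) per)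
      from : ∀ {x} → x ∈ filter (λ x → period x ∣? q) L → x ∈ filter (hasPeriod? q) all
      from {x} x∈ =
        let x∈L , period∣q = ∈-filter⁻ (λ x → period x ∣? q) {xs = L} x∈
            per = proj₂ (∈-filter⁻ (hasPeriod? p) {xs = all} x∈L)
        in ∈-filter⁺ (hasPeriod? q) (words-complete x)
             (hasPeriod-∣ {period x} (proj₁ (proj₂ (period-exact (to-N per)))) period∣q)

  attractorsOfPeriod : ∀ p .{{_ : NonZero p}} → p ∣ N →
    ∃[ a ] HasCardinality (AttractorsOfPeriod ℓ r p) a
         × ∑ (divisors p) (λ q → μ (p ÷ q) ℤ.* + periodicCount q) ≡ + (a * p)
  attractorsOfPeriod p p∣N = length A.representatives , A.orbits-cardinality , (begin
    ∑ (divisors p) (λ q → μ (p ÷ q) ℤ.* + periodicCount q)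
      ≡⟨ convolution μ p p∣N ⟩
    ∑ L (λ x → ∑ (divisors (p ÷ period x)) (λ e → μ (p ÷ period x ÷ e)))
      ≡⟨ ∑-cong L (λ {x} x∈ → ∑μ (p ÷ period x) {{quotient-nonZero x∈}}) ⟩
    ∑ L (λ x → if does (p ÷ period x ≟ 1) then 1ℤ else 0ℤ)
      ≡⟨ ∑-filter (λ x → p ÷ period x ≟ 1) L (λ _ → 1ℤ) ⟨
    ∑ (filter (λ x → p ÷ period x ≟ 1) L) (λ _ → 1ℤ)
      ≡⟨ ∑-↭ (λ _ → 1ℤ) exact-↭ ⟩
    ∑ (filter (exact? p) all) (λ _ → 1ℤ)
      -- On configurations of exact period p the weight 1 is p ÷ p, the weight of `∑-orbits` for c =
      -- p.
      ≡⟨ ∑-cong (filter (exact? p) all) (λ x∈ → cong +_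
           (p÷period≡1 (proj₂ (∈-filter⁻ (exact? p) {xs = all} x∈)))) ⟨
    ∑ (filter (exact? p) all) (λ x → + (p ÷ period x))
      ≡⟨ A.∑-orbits p (λ ex → ∣-reflexive (period-≡ {p} ex)) ⟩
    + (length A.representatives * p) ∎)
    where
    open ≡-Reasoning
    module A = Attractor (exact? p) (exact⇒period-N {p}) (exact-F^ {p})
    L = filter (hasPeriod? p) all
    p÷period≡1 : ∀ {x} → HasExactPeriod ℓ r p x → p ÷ period x ≡ 1
    p÷period≡1 {x} ex = trans (cong (p ÷_) (period-≡ {p} ex))
      (trans (cong (_÷ p) (sym (*-identityʳ p))) (m*n÷m≡n p 1))
    period-* : ∀ {x} → x ∈ L → HasPeriod ℓ r N x × period x * (p ÷ period x) ≡ p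
    period-* {x} x∈ =
      let per = proj₂ (∈-filter⁻ (hasPeriod? p) {xs = all} x∈) ; per-N = hasPeriod-∣ {p} per p∣N in
      per-N , m*[n÷m]≡n {{period-nonZero per-N}} (exact-∣ {period x} {p} (period-exact per-N) per)
    quotient-nonZero : ∀ {x} → x ∈ L → NonZero (p ÷ period x)
    quotient-nonZero {x} x∈ = m*n≢0⇒n≢0 (period x)
      {{subst NonZero (sym (proj₂ (period-* x∈))) (≢-nonZero (≢-nonZero⁻¹ p))}}
    exact-↭ : filter (λ x → p ÷ period x ≟ 1) L ↭ filter (exact? p) all
    exact-↭ = unique⇒↭
      (Unique.filter⁺ _ (Unique.filter⁺ (hasPeriod? p) (words-unique (ℓ + pred r))))
      (Unique.filter⁺ (exact? p) (words-unique (ℓ + pred r)))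
      to from
      where
      to : ∀ {x} → x ∈ filter (λ x → p ÷ period x ≟ 1) L → x ∈ filter (exact? p) all
      to {x} x∈ =
        let x∈L , q≡1 = ∈-filter⁻ (λ x → p ÷ period x ≟ 1) {xs = L} x∈
            per-N , period*q≡p = period-* x∈L
            period≡p = trans (sym (*-identityʳ (period x))) (trans (cong (period x *_) (sym q≡1)) period*q≡p)
        in ∈-filter⁺ (exact? p) (words-complete x)
             (subst (λ p → HasExactPeriod ℓ r p x) period≡p (period-exact per-N))
      from : ∀ {x} → x ∈ filter (exact? p) all → x ∈ filter (λ x → p ÷ period x ≟ 1) L
      from {x} x∈ = let ex = proj₂ (∈-filter⁻ (exact? p) {xs = all} x∈) in
        ∈-filter⁺ (λ x → p ÷ period x ≟ 1)
          (∈-filter⁺ (hasPeriod? p) (words-complete x) (proj₁ (proj₂ ex)))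
          (p÷period≡1 ex)

  attractors :
    ∃[ t ] HasCardinality (Attractors ℓ r) t
         × ∑ (divisors N) (λ q → + ψ (N ÷ q) ℤ.* + periodicCount q) ≡ + (t * N)
  attractors = length A.representatives , A.orbits-cardinality , (begin
    ∑ (divisors N) (λ q → + ψ (N ÷ q) ℤ.* + periodicCount q)
      ≡⟨ convolution (λ n → + ψ n) N ∣-refl ⟩
    ∑ L (λ x → ∑ (divisors (N ÷ period x)) (λ e → + ψ (N ÷ period x ÷ e)))
      -- `ψ` gives each element of an orbit of size d the weight N / d, so orbits of every size
      -- contribute the same total N.
      ≡⟨ ∑-cong L (λ {x} x∈ → ∑ψ (N ÷ period x) {{quotient-nonZero x∈}}) ⟩
    ∑ L (λ x → + (N ÷ period x))
      ≡⟨ ∑-↭ _ periodic-↭ ⟩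
    ∑ (filter periodic? all) (λ x → + (N ÷ period x))
      ≡⟨ A.∑-orbits N (λ {x} (p , ex) → period∣N (exact⇒period-N {p} ex)) ⟩
    + (length A.representatives * N) ∎)
    where
    open ≡-Reasoning
    module A = Attractor periodic? (λ (p , ex) → exact⇒period-N {p} ex) (λ k (p , ex) → p , exact-F^ {p} k ex)
    L = filter (hasPeriod? N) all
    period∣N : ∀ {x} → HasPeriod ℓ r N x → period x ∣ N
    period∣N {x} per = exact-∣ {period x} {N} (period-exact per) per
    quotient-nonZero : ∀ {x} → x ∈ L → NonZero (N ÷ period x)
    quotient-nonZero {x} x∈ = m*n≢0⇒n≢0 (period x)
      {{subst NonZero (sym (m*[n÷m]≡n {{period-nonZero per}} (period∣N per))) N≢0}}
      where
      per = proj₂ (∈-filter⁻ (hasPeriod? N) {xs = all} x∈)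
    periodic-↭ : L ↭ filter periodic? all
    periodic-↭ = unique⇒↭
      (Unique.filter⁺ (hasPeriod? N) (words-unique (ℓ + pred r)))
      (Unique.filter⁺ periodic? (words-unique (ℓ + pred r)))
      (λ {x} x∈ → let per = proj₂ (∈-filter⁻ (hasPeriod? N) {xs = all} x∈) in
        ∈-filter⁺ periodic? (words-complete x) (period x , period-exact per))
      (λ {x} x∈ → let p , ex = proj₂ (∈-filter⁻ periodic? {xs = all} x∈) in
        ∈-filter⁺ (hasPeriod? N) (words-complete x) (exact⇒period-N {p} ex))

-- Dependence on the parameters and the rational formulas

C-cong : ∀ m {d d′} .{{_ : NonZero d}} .{{_ : NonZero d′}} → d ≡ d′ → C m d ≡ C m d′
C-cong m refl = refl

CΔ-cong : ∀ ℓ r ℓ′ r′ m .{{_ : NonZero m}} → Δ ℓ′ r′ m ≡ Δ ℓ r m → CΔ ℓ′ r′ m ≡ CΔ ℓ r m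
CΔ-cong ℓ r ℓ′ r′ m = C-cong m {{Δ-nonZero ℓ′ r′ m}} {{Δ-nonZero ℓ r m}}

-- The division in the attractor formulas is exact, so equality of fractions is the integer identity
-- after cross-multiplication.
/1≡/ : ∀ {s} a n .{{_ : NonZero n}} → s ≡ + (a * n) → (+ a) ℚ./ 1 ≡ s ℚ./ n
/1≡/ {s} a (suc k) s≡a*n = fromℚᵘ-cong {mkℚᵘ (+ a) 0} {mkℚᵘ s k} (*≡* (begin
  + a ℤ.* + suc k   ≡⟨ ℤ.pos-* a (suc k) ⟨
  + (a * suc k)     ≡⟨ s≡a*n ⟨
  s                 ≡⟨ ℤ.*-identityʳ s ⟨
  s ℤ.* + 1         ∎))
  where open ≡-Reasoning

module _ (ℓ r : ℕ) .{{_ : NonZero ℓ}} .{{_ : NonZero r}} where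

  ∑CΔ≡∑periodicCount : ∀ (g : ℕ → ℤ) p .{{_ : NonZero p}} → p ∣ ℓ + r →
    (∑[ q ∣ p ] (g (p / q) ℤ.* + CΔ ℓ r q)) ≡ ∑ (divisors p) (λ q → g (p ÷ q) ℤ.* + periodicCount ℓ r q)
  ∑CΔ≡∑periodicCount g p p∣N = sumOverDivisors≡∑ p (λ q → g (p / q) ℤ.* + CΔ ℓ r q) _ λ q q∣p →
    cong₂ (λ n c → g n ℤ.* + c) (/≡÷ p q) (CΔ≡periodicCount ℓ r q (∣-trans q∣p p∣N))

-- N times the number of attractors is a sum whose terms depend on ℓ and r only through N and their
-- gcd, and N can be cancelled.
attractors-count-cong : ∀ (ℓ r ℓ′ r′ : ℕ) .{{_ : NonZero ℓ}} .{{_ : NonZero r}}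
  .{{_ : NonZero ℓ′}} .{{_ : NonZero r′}} →
  ℓ′ + r′ ≡ ℓ + r → gcd ℓ′ r′ ≡ gcd ℓ r →
  proj₁ (attractors ℓ′ r′) ≡ proj₁ (attractors ℓ r)
attractors-count-cong ℓ r ℓ′ r′ N′≡N gcd′≡gcd = *-cancelʳ-≡ t′ t N (ℤ.+-injective (begin
  + (t′ * N)                                  ≡⟨ cong (λ n → + (t′ * n)) N′≡N ⟨
  + (t′ * N′)                                 ≡⟨ proj₂ (proj₂ (attractors ℓ′ r′)) ⟨
  ∑ (divisors N′) (λ q → + ψ (N′ ÷ q) ℤ.* + periodicCount ℓ′ r′ q)
    ≡⟨ cong (λ n → ∑ (divisors n) (λ q → + ψ (n ÷ q) ℤ.* + periodicCount ℓ′ r′ q)) N′≡N ⟩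
  ∑ (divisors N) (λ q → + ψ (N ÷ q) ℤ.* + periodicCount ℓ′ r′ q)
    ≡⟨ ∑-cong (divisors N) (λ {q} q∈ → let q≢0 , q∣N = ∈-divisors⁻ q∈ in
         cong (λ c → + ψ (N ÷ q) ℤ.* + c) (same-count q {{q≢0}} q∣N)) ⟩
  ∑ (divisors N) (λ q → + ψ (N ÷ q) ℤ.* + periodicCount ℓ r q)
    ≡⟨ proj₂ (proj₂ (attractors ℓ r)) ⟩
  + (t * N) ∎))
  where
  open ≡-Reasoning
  N  = ℓ + r
  N′ = ℓ′ + r′
  t  = proj₁ (attractors ℓ r)
  t′ = proj₁ (attractors ℓ′ r′)
  instance _ = +-nonZero ℓ r
  same-count : ∀ q .{{_ : NonZero q}} → q ∣ N → periodicCount ℓ′ r′ q ≡ periodicCount ℓ r q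
  same-count q q∣N = begin
    periodicCount ℓ′ r′ q ≡⟨ CΔ≡periodicCount ℓ′ r′ q (subst (q ∣_) (sym N′≡N) q∣N) ⟨
    CΔ ℓ′ r′ q            ≡⟨ CΔ-cong ℓ r ℓ′ r′ q (cong (λ g → gcd g q) gcd′≡gcd) ⟩
    CΔ ℓ r q              ≡⟨ CΔ≡periodicCount ℓ r q q∣N ⟩
    periodicCount ℓ r q   ∎

proposition6 : ∀ (ℓ r : ℕ) .{{_ : NonZero ℓ}} .{{_ : NonZero r}} →
    let instance N≢0 = +-nonZero ℓ r in
    (∀ (p : ℕ) .{{_ : NonZero p}} → p ∣ ℓ + r → ¬ (p ∣ ℓ) → ¬ (p ∣ r) →
    HasCardinality (PeriodicConfigs ℓ r p) (CΔ ℓ r p)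
    × (∀ (ℓ′ r′ : ℕ) .{{_ : NonZero ℓ′}} .{{_ : NonZero r′}} →
    p ∣ ℓ′ + r′ → ¬ (p ∣ ℓ′) → ¬ (p ∣ r′) → Δ ℓ′ r′ p ≡ Δ ℓ r p →
    ∀ c → HasCardinality (PeriodicConfigs ℓ r p) c →
    HasCardinality (PeriodicConfigs ℓ′ r′ p) c)
    × (∃[ a ] HasCardinality (AttractorsOfPeriod ℓ r p) a
    × (+ a) ℚ./ 1 ≡ (∑[ q ∣ p ] (μ (p / q) ℤ.* + CΔ ℓ r q)) ℚ./ p))
    × (∃[ t ] HasCardinality (Attractors ℓ r) t
    × (+ t) ℚ./ 1 ≡ (∑[ m ∣ ℓ + r ] (+ ψ ((ℓ + r) / m) ℤ.* + CΔ ℓ r m)) ℚ./ (ℓ + r))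
    × (∀ (ℓ′ r′ : ℕ) .{{_ : NonZero ℓ′}} .{{_ : NonZero r′}} →
    ℓ′ + r′ ≡ ℓ + r → gcd ℓ′ r′ ≡ gcd ℓ r →
    ∀ t → HasCardinality (Attractors ℓ r) t → HasCardinality (Attractors ℓ′ r′) t)
proposition6 ℓ r =
  (λ p p∣N _ _ →
    periodicConfigs-cardinality ℓ r p p∣N ,
    (λ ℓ′ r′ p∣N′ _ _ Δ′≡Δ c card →
      subst (HasCardinality (PeriodicConfigs ℓ′ r′ p))
        (trans (CΔ-cong ℓ r ℓ′ r′ p Δ′≡Δ) (cardinality-unique (periodicConfigs-cardinality ℓ r p p∣N) card))
        (periodicConfigs-cardinality ℓ′ r′ p p∣N′)) ,
    (let a , card , ∑≡a*p = attractorsOfPeriod ℓ r p p∣N in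
     a , card , /1≡/ a p (trans (∑CΔ≡∑periodicCount ℓ r μ p p∣N) ∑≡a*p))) ,
  (let t , card , ∑≡t*N = attractors ℓ r in
   t , card , /1≡/ t (ℓ + r) {{N≢0}}
     (trans (∑CΔ≡∑periodicCount ℓ r (λ n → + ψ n) (ℓ + r) {{N≢0}} ∣-refl) ∑≡t*N)) ,
  (λ ℓ′ r′ N′≡N gcd′≡gcd t card →
    subst (HasCardinality (Attractors ℓ′ r′))
      (trans (attractors-count-cong ℓ r ℓ′ r′ N′≡N gcd′≡gcd)
        (cardinality-unique (proj₁ (proj₂ (attractors ℓ r))) card))
      (proj₁ (proj₂ (attractors ℓ′ r′))))
  where
  N≢0 = +-nonZero ℓ r
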